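{- Let $m\ge 2$, let $G=(V,E)$ be a unit disk graph that has a $(2,m)$-CDS, and let $\mathrm{OPT}$ be the minimum cardinality of a $(2,m)$-CDS of $G$. Then the algorithm of Shang et al. (described in the context) attains approximation factor $5+35/m$ for $2\le m\le 5$ and $13-5/m$ for $m\ge 6$; that is, the $(2,m)$-CDS $T\cup S$ it outputs satisfies $|T\cup S|\le (5+35/m)\,\mathrm{OPT}$ if $2\le m\le 5$, and $|T\cup S|\le(13-5/m)\,\mathrm{OPT}$ if $m\ge 6$.
   Context: In a unit disk graph, each node is placed at a point of the Euclidean plane, and two nodes are joined by an edge if and only if their distance is at most a unit length. $G[X]$ is the subgraph induced by $X$. A graph is $k$-connected if it is connected even when any $k-1$ or fewer nodes are removed (a complete graph on at most $k$ nodes is $k$-connected by convention). A $(k,m)$-CDS is a set $S\subseteq V$ such that $G[S]$ is $k$-connected and each node of $V\setminus S$ has at least $m$ neighbors in $S$. For $X\subseteq V$: $\Gamma(X)$ is the set of nodes outside $X$ adjacent to a node of $X$, $X^+=X\cup\Gamma(X)$, $\Gamma_T(X)=\Gamma(X)\cap T$. A $T$-cut is a set $X\subseteq T$ with $X\neq\emptyset\neq T\setminus X^+$. A $T$-path is a path whose two end nodes are in $T$ and whose inner nodes are not in $T$; it covers a $T$-cut $X$ if one end node is in $X$ and the other is in $T\setminus X^+$. Algorithm of Shang et al.: Let $I_0=\emptyset$. For $i=1,\dots,m$, compute a maximal independent set $I_i$ of $G[V\setminus\bigcup_{i'=0}^{i-1}I_{i'}]$; also compute $C\subseteq V\setminus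 I_1$ with $|C|\le|I_1|$ and $G[C\cup I_1]$ connected. Set $T=\bigcup_{i=1}^m I_i\cup C$ (a $(1,m)$-CDS) and $S=\emptyset$. While $T\cup S$ is not $2$-connected: find a $T$-cut $X$ with $|\Gamma_T(X)|=1$ that is covered by no $T$-path of $G[T\cup S]$; find a $T$-path of $G$ that covers $X$ and has at most two inner nodes; add these inner nodes to $S$. Output $T\cup S$. -}

module Defs where

open import Level using (0ℓ)
open import Data.Fin using (Fin)
open import Data.Fin.Properties using (any?)
open import Data.Fin.Subset
open import Data.Fin.Subset.Properties using (_∈?_)
open import Data.Integer using (+_)
open import Data.List using (List; []; _∷_; _∷ʳ_; length; map)
open import Data.List.Relation.Unary.All using (All)
open import Data.List.Relation.Unary.Linked using (Linked)
open import Data.List.Relation.Unary.Unique.Propositional using (Unique)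
open import Data.Nat as ℕ using (ℕ; zero; suc)
import Data.Nat.Properties as ℕₚ
open import Data.Product using (Σ; Σ-syntax; ∃; ∃-syntax; _×_; _,_; proj₁; proj₂)
open import Data.Rational as ℚ using (ℚ; 0ℚ; 1ℚ; ½)
import Data.Rational.Properties as ℚₚ
open import Data.Rational.Solver using (module +-*-Solver)
open import Data.Sum using (_⊎_)
open import Data.Vec using (tabulate)
open import Function using (_⇔_)
open import Relation.Binary.Core using (Rel)
open import Relation.Binary.Construct.Closure.ReflexiveTransitive using (Star)
open import Relation.Binary.Definitions using (Decidable; Symmetric; Irreflexive)
open import Relation.Binary.PropositionalEquality
  using (_≡_; _≢_; refl; sym; trans; cong; subst; subst₂)
open import Relation.Nullary using (¬_; ¬?; _×-dec_; does)
import Relation.Unary as Pred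

-- A real is a Cauchy sequence of rationals. Equality of reals is mutual
-- _≤ᴿ_ rather than _≡_.

IsCauchy : (ℕ → ℚ) → Set
IsCauchy x = ∀ ε → 0ℚ ℚ.< ε →
  ∃[ N ] (∀ i j → N ℕ.≤ i → N ℕ.≤ j → ℚ.∣ x i ℚ.- x j ∣ ℚ.< ε)

record ℝ : Set where
  constructor mkℝ
  field
    seq    : ℕ → ℚ
    cauchy : IsCauchy seq

open ℝ public

fromℚ : ℚ → ℝ
fromℚ q = mkℝ (λ _ → q) λ ε ε>0 →
  0 , λ _ _ _ _ → subst (λ d → ℚ.∣ d ∣ ℚ.< ε) (sym (ℚₚ.+-inverseʳ q)) ε>0

1ᴿ : ℝ
1ᴿ = fromℚ 1ℚ

infix 4 _≤ᴿ_

_≤ᴿ_ : ℝ → ℝ → Set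
x ≤ᴿ y = ∀ ε → 0ℚ ℚ.< ε →
  ∃[ N ] (∀ i → N ℕ.≤ i → seq x i ℚ.≤ seq y i ℚ.+ ε)

private

  half-pos : ∀ {ε} → 0ℚ ℚ.< ε → 0ℚ ℚ.< ½ ℚ.* ε
  half-pos {ε} ε>0 = ℚₚ.positive⁻¹ (½ ℚ.* ε)
    where instance _ = ℚₚ.pos*pos⇒pos ½ ε {{ℚ.positive ε>0}}

  half+half : ∀ ε → ½ ℚ.* ε ℚ.+ ½ ℚ.* ε ≡ ε
  half+half ε = trans (sym (ℚₚ.*-distribʳ-+ ε ½ ½)) (ℚₚ.*-identityˡ ε)

  +-cauchy : ∀ {x y} → IsCauchy x → IsCauchy y → IsCauchy (λ i → x i ℚ.+ y i)
  +-cauchy {x} {y} cx cy ε ε>0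
    with cx (½ ℚ.* ε) (half-pos ε>0) | cy (½ ℚ.* ε) (half-pos ε>0)
  ... | M , hx | N , hy = M ℕ.⊔ N , λ i j p q →
    subst₂ (λ d e → ℚ.∣ d ∣ ℚ.< e) (rearrange (x i) (y i) (x j) (y j)) (half+half ε)
      (ℚₚ.≤-<-trans (ℚₚ.∣p+q∣≤∣p∣+∣q∣ (x i ℚ.- x j) (y i ℚ.- y j))
        (ℚₚ.+-mono-< (hx i j (ℕₚ.m⊔n≤o⇒m≤o M N p) (ℕₚ.m⊔n≤o⇒m≤o M N q))
                     (hy i j (ℕₚ.m⊔n≤o⇒n≤o M N p) (ℕₚ.m⊔n≤o⇒n≤o M N q))))
    where
    open +-*-Solver
    rearrange : ∀ a b c d → (a ℚ.- c) ℚ.+ (b ℚ.- d) ≡ (a ℚ.+ b) ℚ.- (c ℚ.+ d)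
    rearrange = solve 4
      (λ a b c d → (a :- c) :+ (b :- d) := (a :+ b) :- (c :+ d)) refl

  neg-cauchy : ∀ {x} → IsCauchy x → IsCauchy (λ i → ℚ.- x i)
  neg-cauchy {x} cx ε ε>0 with cx ε ε>0
  ... | N , hx = N , λ i j p q →
    subst (ℚ._< ε)
      (trans (sym (ℚₚ.∣-p∣≡∣p∣ (x i ℚ.- x j)))
             (cong ℚ.∣_∣ (ℚₚ.neg-distrib-+ (x i) (ℚ.- x j))))
      (hx i j p q)

  bounded : ∀ {x} → IsCauchy x →
            Σ[ B ∈ ℚ ] (0ℚ ℚ.< B) × ∃[ N ] (∀ i → N ℕ.≤ i → ℚ.∣ x i ∣ ℚ.≤ B)
  bounded {x} cx with cx 1ℚ (ℚₚ.positive⁻¹ 1ℚ)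
  ... | N , hx = 1ℚ ℚ.+ ℚ.∣ x N ∣
               , ℚₚ.+-mono-<-≤ (ℚₚ.positive⁻¹ 1ℚ) (ℚₚ.0≤∣p∣ (x N))
               , N , λ i p →
    subst (λ d → ℚ.∣ d ∣ ℚ.≤ 1ℚ ℚ.+ ℚ.∣ x N ∣) (cancel (x i) (x N))
      (ℚₚ.≤-trans (ℚₚ.∣p+q∣≤∣p∣+∣q∣ (x i ℚ.- x N) (x N))
        (ℚₚ.+-monoˡ-≤ ℚ.∣ x N ∣ (ℚₚ.<⇒≤ (hx i N p ℕₚ.≤-refl))))
    where
    open +-*-Solver
    cancel : ∀ a b → (a ℚ.- b) ℚ.+ b ≡ a
    cancel = solve 2 (λ a b → (a :- b) :+ b := a) refl

  split : ∀ {A B ε} → 0ℚ ℚ.< A → 0ℚ ℚ.< B → 0ℚ ℚ.< ε →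
          Σ[ δ ∈ ℚ ] (0ℚ ℚ.< δ) × (A ℚ.* δ ℚ.+ δ ℚ.* B ≡ ε)
  split {A} {B} {ε} A>0 B>0 ε>0 = c ℚ.* ε , δ>0 ,
    trans (regroup A B c ε)
      (trans (cong (ℚ._* ε) (ℚₚ.*-inverseʳ (A ℚ.+ B) {{nonZero}})) (ℚₚ.*-identityˡ ε))
    where
    open +-*-Solver
    pos : ℚ.Positive (A ℚ.+ B)
    pos = ℚ.positive (ℚₚ.+-mono-< A>0 B>0)

    nonZero : ℚ.NonZero (A ℚ.+ B)
    nonZero = ℚₚ.pos⇒nonZero (A ℚ.+ B) {{pos}}

    c : ℚ
    c = (ℚ.1/ (A ℚ.+ B)) {{nonZero}}

    δ>0 : 0ℚ ℚ.< c ℚ.* ε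
    δ>0 = ℚₚ.positive⁻¹ (c ℚ.* ε)
      {{ℚₚ.pos*pos⇒pos c {{ℚₚ.1/pos⇒pos (A ℚ.+ B) {{pos}}}} ε {{ℚ.positive ε>0}}}}

    regroup : ∀ a b c e → a ℚ.* (c ℚ.* e) ℚ.+ (c ℚ.* e) ℚ.* b
                        ≡ ((a ℚ.+ b) ℚ.* c) ℚ.* e
    regroup = solve 4 (λ a b c e →
      a :* (c :* e) :+ (c :* e) :* b := ((a :+ b) :* c) :* e) refl

  ∣*∣-< : ∀ {a d A δ} → 0ℚ ℚ.< A → ℚ.∣ a ∣ ℚ.≤ A → ℚ.∣ d ∣ ℚ.< δ →
          ℚ.∣ a ℚ.* d ∣ ℚ.< A ℚ.* δ
  ∣*∣-< {a} {d} {A} {δ} A>0 a≤A d<δ =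
    subst (ℚ._< A ℚ.* δ) (sym (ℚₚ.∣p*q∣≡∣p∣*∣q∣ a d))
      (ℚₚ.≤-<-trans
        (ℚₚ.*-monoʳ-≤-nonNeg ℚ.∣ d ∣ {{ℚ.nonNegative (ℚₚ.0≤∣p∣ d)}} a≤A)
        (ℚₚ.*-monoʳ-<-pos A {{ℚ.positive A>0}} d<δ))

  product-close : ∀ a b c d {A B δ ε} → 0ℚ ℚ.< A → 0ℚ ℚ.< B →
    A ℚ.* δ ℚ.+ δ ℚ.* B ≡ ε → ℚ.∣ a ∣ ℚ.≤ A → ℚ.∣ d ∣ ℚ.≤ B →
    ℚ.∣ a ℚ.- c ∣ ℚ.< δ → ℚ.∣ b ℚ.- d ∣ ℚ.< δ →
    ℚ.∣ a ℚ.* b ℚ.- c ℚ.* d ∣ ℚ.< ε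
  product-close a b c d {A} {B} {δ} A>0 B>0 eq a≤A d≤B ac bd =
    subst₂ (λ e f → ℚ.∣ e ∣ ℚ.< f) (rearrange a b c d) eq
      (ℚₚ.≤-<-trans
        (ℚₚ.∣p+q∣≤∣p∣+∣q∣ (a ℚ.* (b ℚ.- d)) ((a ℚ.- c) ℚ.* d))
        (ℚₚ.+-mono-< (∣*∣-< A>0 a≤A bd)
          (subst₂ (λ e f → ℚ.∣ e ∣ ℚ.< f) (ℚₚ.*-comm d (a ℚ.- c)) (ℚₚ.*-comm B δ)
            (∣*∣-< B>0 d≤B ac))))
    where
    open +-*-Solver
    rearrange : ∀ a b c d → a ℚ.* (b ℚ.- d) ℚ.+ (a ℚ.- c) ℚ.* d
                          ≡ a ℚ.* b ℚ.- c ℚ.* d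
    rearrange = solve 4 (λ a b c d →
      a :* (b :- d) :+ (a :- c) :* d := a :* b :- c :* d) refl

  *-cauchy : ∀ {x y} → IsCauchy x → IsCauchy y → IsCauchy (λ i → x i ℚ.* y i)
  *-cauchy {x} {y} cx cy ε ε>0 =
    let A , A>0 , K , hA = bounded {x} cx
        B , B>0 , L , hB = bounded {y} cy
        δ , δ>0 , eq     = split A>0 B>0 ε>0
        P , hx           = cx δ δ>0
        Q , hy           = cy δ δ>0
    in (K ℕ.⊔ L) ℕ.⊔ (P ℕ.⊔ Q) , λ i j p q →
      let pKL = ℕₚ.m⊔n≤o⇒m≤o (K ℕ.⊔ L) (P ℕ.⊔ Q) p
          qKL = ℕₚ.m⊔n≤o⇒m≤o (K ℕ.⊔ L) (P ℕ.⊔ Q) q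
          pPQ = ℕₚ.m⊔n≤o⇒n≤o (K ℕ.⊔ L) (P ℕ.⊔ Q) p
          qPQ = ℕₚ.m⊔n≤o⇒n≤o (K ℕ.⊔ L) (P ℕ.⊔ Q) q
      in product-close (x i) (y i) (x j) (y j) A>0 B>0 eq
           (hA i (ℕₚ.m⊔n≤o⇒m≤o K L pKL)) (hB j (ℕₚ.m⊔n≤o⇒n≤o K L qKL))
           (hx i j (ℕₚ.m⊔n≤o⇒m≤o P Q pPQ) (ℕₚ.m⊔n≤o⇒m≤o P Q qPQ))
           (hy i j (ℕₚ.m⊔n≤o⇒n≤o P Q pPQ) (ℕₚ.m⊔n≤o⇒n≤o P Q qPQ))

infixl 6 _+ᴿ_ _-ᴿ_
infixl 7 _*ᴿ_
infix  8 -ᴿ_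

_+ᴿ_ : ℝ → ℝ → ℝ
x +ᴿ y = mkℝ (λ i → seq x i ℚ.+ seq y i) (+-cauchy {seq x} {seq y} (cauchy x) (cauchy y))

-ᴿ_ : ℝ → ℝ
-ᴿ x = mkℝ (λ i → ℚ.- seq x i) (neg-cauchy {seq x} (cauchy x))

_-ᴿ_ : ℝ → ℝ → ℝ
x -ᴿ y = x +ᴿ (-ᴿ y)

_*ᴿ_ : ℝ → ℝ → ℝ
x *ᴿ y = mkℝ (λ i → seq x i ℚ.* seq y i) (*-cauchy {seq x} {seq y} (cauchy x) (cauchy y))

Point : Set
Point = ℝ × ℝ

dist² : Point → Point → ℝ
dist² (x , y) (x′ , y′) =
  (x -ᴿ x′) *ᴿ (x -ᴿ x′) +ᴿ (y -ᴿ y′) *ᴿ (y -ᴿ y′)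

record Graph (n : ℕ) : Set₁ where
  infix 4 _~_ _~?_
  field
    _~_    : Rel (Fin n) 0ℓ
    _~?_   : Decidable _~_
    symm   : Symmetric _~_
    irrefl : Irreflexive _≡_ _~_

-- The unit of length is 1, and dist ≤ 1 is expressed as dist² ≤ 1.
IsUnitDisk : ∀ {n} → Graph n → Set
IsUnitDisk {n} G = Σ[ pos ∈ (Fin n → Point) ]
  (∀ u v → u ≢ v → (u ~ v) ⇔ (dist² (pos u) (pos v) ≤ᴿ 1ᴿ))
  where open Graph G

⟪_⟫ : ∀ {n} {P : Pred.Pred (Fin n) 0ℓ} → Pred.Decidable P → Subset n
⟪ P? ⟫ = tabulate (λ v → does (P? v))

fromList : ∀ {n} → List (Fin n) → Subset n
fromList vs = ⋃ (map ⁅_⁆ vs)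

module _ {n : ℕ} (G : Graph n) where
  open Graph G

  N : Fin n → Subset n
  N v = ⟪ v ~?_ ⟫

  Γ : Subset n → Subset n
  Γ X = ⟪ (λ v → ¬? (v ∈? X) ×-dec any? (λ u → (u ∈? X) ×-dec (u ~? v))) ⟫

  infix 8 _⁺
  _⁺ : Subset n → Subset n
  X ⁺ = X ∪ Γ X

  Γ[_] : Subset n → Subset n → Subset n
  Γ[ T ] X = Γ X ∩ T

  EdgeIn : Subset n → Rel (Fin n) 0ℓ
  EdgeIn U u v = u ∈ U × v ∈ U × u ~ v

  -- G[U] is connected (the graph without nodes counts as connected).
  Connected : Subset n → Set
  Connected U = ∀ {u v} → u ∈ U → v ∈ U → Star (EdgeIn U) u v

  Complete : Subset n → Set
  Complete U = ∀ {u v} → u ∈ U → v ∈ U → u ≢ v → u ~ v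

  KConnected : ℕ → Subset n → Set
  KConnected k U = (∀ R → ∣ R ∣ ℕ.< k → Connected (U ─ R))
                 ⊎ (Complete U × ∣ U ∣ ℕ.≤ k)

  MDominating : ℕ → Subset n → Set
  MDominating m S = ∀ v → v ∉ S → m ℕ.≤ ∣ N v ∩ S ∣

  IsCDS : ℕ → ℕ → Subset n → Set
  IsCDS k m S = KConnected k S × MDominating m S

  -- In particular, G has a (k,m)-CDS.
  IsMinCDSSize : ℕ → ℕ → ℕ → Set
  IsMinCDSSize k m opt = (∃[ S ] IsCDS k m S × ∣ S ∣ ≡ opt)
                       × (∀ S → IsCDS k m S → opt ℕ.≤ ∣ S ∣)

  Independent : Subset n → Set
  Independent I = ∀ {u v} → u ∈ I → v ∈ I → ¬ (u ~ v)

  IsMaximalIndependentIn : Subset n → Subset n → Set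
  IsMaximalIndependentIn W I =
    I ⊆ W × Independent I × (∀ J → J ⊆ W → Independent J → I ⊆ J → J ⊆ I)

  IsTCut : Subset n → Subset n → Set
  IsTCut T X = X ⊆ T × Nonempty X × Nonempty (T ─ X ⁺)

  -- A T-path of G[U].
  record TPath (T U : Subset n) : Set where
    field
      start end : Fin n
      inner     : List (Fin n)

    nodes : List (Fin n)
    nodes = start ∷ (inner ∷ʳ end)

    field
      distinct : Unique nodes
      adjacent : Linked _~_ nodes
      nodes∈U  : All (_∈ U) nodes
      start∈T  : start ∈ T
      end∈T    : end ∈ T
      inner∉T  : All (_∉ T) inner

  Covers : ∀ {T U} → TPath T U → Subset n → Set
  Covers {T} P X = (start ∈ X × end ∈ T ─ X ⁺) ⊎ (end ∈ X × start ∈ T ─ X ⁺)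
    where open TPath P

  ⋃[<_] : ℕ → (ℕ → Subset n) → Subset n
  ⋃[< zero ]  I = ⊥
  ⋃[< suc i ] I = ⋃[< i ] I ∪ I i

  -- Only the values I 0, …, I m matter.
  record Initial (m : ℕ) (T : Subset n) : Set where
    field
      I           : ℕ → Subset n
      C           : Subset n
      I₀-empty    : I 0 ≡ ⊥
      I-maximal   : ∀ i → 1 ℕ.≤ i → i ℕ.≤ m →
                    IsMaximalIndependentIn (∁ (⋃[< i ] I)) (I i)
      C-disjoint  : C ⊆ ∁ (I 1)
      C-small     : ∣ C ∣ ℕ.≤ ∣ I 1 ∣
      C-connected : Connected (C ∪ I 1)
      T-def       : T ≡ ⋃[< suc m ] I ∪ C

  data Step (T S : Subset n) : Subset n → Set where
    step : ¬ KConnected 2 (T ∪ S) →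
           ∀ X → IsTCut T X → ∣ Γ[ T ] X ∣ ≡ 1 →
           ¬ (Σ[ Q ∈ TPath T (T ∪ S) ] Covers Q X) →
           (P : TPath T ⊤) → Covers P X → length (TPath.inner P) ℕ.≤ 2 →
           Step T S (S ∪ fromList (TPath.inner P))

  -- The algorithm's choices are nondeterministic: T and S are the final
  -- values of some execution.
  IsOutput : ℕ → Subset n → Subset n → Set
  IsOutput m T S = Initial m T × Star (Step T) ⊥ S × KConnected 2 (T ∪ S)

size : ∀ {n} → Subset n → ℚ
size U = + ∣ U ∣ ℚ./ 1

-- Suppose six plane vectors have pairwise angles above 60°. The line through one of them bounds a closed
-- half plane with three of the other five, where there is room for only two. So a node of a unit disk graph has at
-- most five independent neighbours, and counting the edges between I ─ D and D ─ I for an optimal D gives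
-- m |I| + 5 |I ∩ D| ≤ m |I ∩ D| + 5 |D| for every independent I; summed over the disjoint I₁, …, Iₘ this
-- bounds |T ─ C|. Each iteration merges two components of G[T ∪ S] − c for a node c of T. Order T so that
-- A = C ∪ I₁ comes first in breadth-first order, then I₂, then the rest. The later of the earliest nodes of
-- the two components is then a node whose only earlier neighbour is c, so it cannot lie behind I₂ (nodes
-- there have earlier neighbours in I₁ and in I₂), and it is used up by the iteration. Thus there are at most
-- |A| + |I₂| iterations, each adding at most two nodes.

module Submission where

open import Defs
open import Data.Bool using (true; false; if_then_else_)
open import Data.Empty using (⊥-elim)
open import Data.Fin using (Fin; zero; suc; toℕ)
open import Data.Fin.Properties using (_≟_; any?; toℕ<n; toℕ-injective)
open import Data.Fin.Subset.Induction using (⊂-wellFounded)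
open import Data.List using (List; []; _∷_; _∷ʳ_; length; map; filter)
import Data.List.Membership.Propositional as List
import Data.List.Properties as List
open import Data.List.Relation.Unary.All as All using (All; []; _∷_)
import Data.List.Relation.Unary.All.Properties as All
open import Data.List.Relation.Unary.AllPairs as AllPairs using (AllPairs; []; _∷_)
import Data.List.Relation.Unary.AllPairs.Properties as AllPairs
open import Data.List.Relation.Unary.Any as Any using (here; there)
open import Data.List.Relation.Unary.Linked using (Linked; [-]; _∷_)
open import Data.List.Relation.Unary.Unique.Propositional using (Unique)
open import Data.Nat as ℕ using (ℕ; zero; suc; s≤s; z≤n; NonZero)
open import Data.Nat.Induction using (<-wellFounded)
import Data.Nat.Properties as ℕₚ
open import Data.Product using (_×_; _,_; proj₁; proj₂; ∃-syntax; Σ-syntax)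
open import Data.Rational as ℚ using (ℚ)
open import Data.Sum using (_⊎_; inj₁; inj₂; [_,_]′)
open import Data.Vec using ([]; _∷_; here; there; lookup)
import Data.Vec.Properties as Vec
open import Function using (_∘_; id; Equivalence)
open import Induction.WellFounded using (Acc; acc)
open import Level using (0ℓ)
open import Relation.Binary.Definitions using (tri<; tri≈; tri>)
open import Relation.Binary.PropositionalEquality using (_≡_; _≢_; refl; sym; trans; cong; cong₂; subst; subst₂)
open import Relation.Nullary using (Dec; ¬_; ¬?; does; yes; no; contradiction; _×-dec_)
open import Relation.Nullary.Decidable using (dec-true)
import Relation.Unary as Pred

-- Angles between plane vectors, in rational arithmetic.

module Plane where

  open import Data.Rational using (ℚ; 0ℚ; 1ℚ; ½; _+_; _*_; _-_; -_; _<_; _≤_; positive; nonNegative)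
  open import Data.Rational.Properties
  open import Data.Rational.Solver using (module +-*-Solver)
  open +-*-Solver

  private variable
    p q r s k x y : ℚ

  0<* : 0ℚ < x → 0ℚ < y → 0ℚ < x * y
  0<* {x} {y} x>0 y>0 = positive⁻¹ (x * y) {{pos*pos⇒pos x {{positive x>0}} y {{positive y>0}}}}

  0≤* : 0ℚ ≤ x → 0ℚ ≤ y → 0ℚ ≤ x * y
  0≤* {x} {y} x≥0 y≥0 =
    nonNegative⁻¹ (x * y) {{nonNeg*nonNeg⇒nonNeg x {{nonNegative x≥0}} y {{nonNegative y≥0}}}}

  0≤² : ∀ x → 0ℚ ≤ x * x
  0≤² x with ≤-total 0ℚ x
  ... | inj₁ x≥0 = 0≤* x≥0 x≥0
  ... | inj₂ x≤0 = subst (0ℚ ≤_) (solve 1 (λ x → (:- x) :* (:- x) := x :* x) refl x)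
                     (0≤* (neg-antimono-≤ x≤0) (neg-antimono-≤ x≤0))

  0≤+ : 0ℚ ≤ x → 0ℚ ≤ y → 0ℚ ≤ x + y
  0≤+ = +-mono-≤

  0<+ : 0ℚ < x → 0ℚ ≤ y → 0ℚ < x + y
  0<+ = +-mono-<-≤

  0<*-cancelʳ : 0ℚ ≤ y → 0ℚ < x * y → 0ℚ < x
  0<*-cancelʳ {y} {x} y≥0 xy>0 =
    *-cancelʳ-<-nonNeg y {{nonNegative y≥0}} (subst (_< x * y) (sym (*-zeroˡ y)) xy>0)

  <⇒0<- : x < y → 0ℚ < y - x
  <⇒0<- {x} {y} x<y = subst (_< y - x) (+-inverseʳ x) (+-monoˡ-< (- x) x<y)

  0<-⇒< : 0ℚ < y - x → x < y
  0<-⇒< {y} {x} d>0 = subst₂ _<_ (+-identityˡ x) (solve 2 (λ x y → (y :- x) :+ x := y) refl x y) (+-monoˡ-< x d>0)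

  0<⇒≢0 : 0ℚ < x → x ≢ 0ℚ
  0<⇒≢0 x>0 x≡0 = <-irrefl (sym x≡0) x>0

  -- The direction (p , q) makes an angle in (60° , 180°] with the positive x-axis.
  Wide : ℚ → ℚ → Set
  Wide p q = (0ℚ ≤ q) × ((p < 0ℚ) ⊎ (0ℚ ≤ p) × (0ℚ < q * q - (p * p + p * p + p * p)))

  0<3*⇒0< : 0ℚ < x + x + x → 0ℚ < x
  0<3*⇒0< {x} h with 0ℚ <? x
  ... | yes x>0 = x>0
  ... | no x≯0 = ⊥-elim (<-irrefl refl (<-≤-trans h (+-mono-≤ (+-mono-≤ (≮⇒≥ x≯0) (≮⇒≥ x≯0)) (≮⇒≥ x≯0))))

  steep⇒0< : 0ℚ ≤ q → 0ℚ < q * q - (p * p + p * p + p * p) → 0ℚ < q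
  steep⇒0< {q} {p} q≥0 h = 0<*-cancelʳ q≥0
    (subst (0ℚ <_)
      (solve 2 (λ p q → (q :* q :- (p :* p :+ p :* p :+ p :* p)) :+ (p :* p :+ p :* p :+ p :* p) := q :* q) refl p q)
      (0<+ h (0≤+ (0≤+ (0≤² p) (0≤² p)) (0≤² p))))

  -- Multiplying `p + iq` by `r + is` adds angles, and two angles in (90°, 180°] add up to one in
  -- (180°, 360°], outside the range of `Wide`. Algebraically, a sum of nonnegative terms, one of
  -- them positive, would vanish identically.
  obtuse*obtuse : p < 0ℚ → 0ℚ ≤ q → r < 0ℚ → 0ℚ ≤ s → ¬ Wide (p * r - q * s) (p * s + q * r)
  obtuse*obtuse {p} {q} {r} {s} p<0 q≥0 r<0 s≥0 (t≥0 , inj₁ m<0) = 0<⇒≢0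
    (0<+ (0<+ (0<* (0<* -r>0 -r>0) -p>0) (0≤* (<⇒≤ -r>0) (<⇒≤ (neg-antimono-< m<0))))
         (0≤+ (0≤* t≥0 s≥0) (0≤* (<⇒≤ -p>0) (0≤² s))))
    (solve 4 (λ p q r s → ((:- r) :* (:- r) :* (:- p) :+ (:- r) :* (:- (p :* r :- q :* s)))
               :+ ((p :* s :+ q :* r) :* s :+ (:- p) :* (s :* s)) := con 0ℚ) refl p q r s)
    where
    -p>0 = neg-antimono-< p<0
    -r>0 = neg-antimono-< r<0
  obtuse*obtuse {p} {q} {r} {s} p<0 q≥0 r<0 s≥0 (t≥0 , inj₂ (m≥0 , h)) = 0<⇒≢0
    (0<+ h (0≤+ (0≤+ (0≤+ (0≤² m) (0≤² m)) (0≤² m))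
       (0≤+ (0≤* t≥0 (0≤* (<⇒≤ -p>0) s≥0)) (0≤* t≥0 (0≤* q≥0 (<⇒≤ -r>0))))))
    (solve 4 (λ p q r s →
       let m = p :* r :- q :* s; t = p :* s :+ q :* r in
       (t :* t :- (m :* m :+ m :* m :+ m :* m)) :+ ((m :* m :+ m :* m :+ m :* m)
         :+ (t :* ((:- p) :* s) :+ t :* (q :* (:- r)))) := con 0ℚ) refl p q r s)
    where
    -p>0 = neg-antimono-< p<0
    -r>0 = neg-antimono-< r<0
    m = p * r - q * s

  -- For 0 ≤ t, the direction (m , t) makes an angle in (120° , 180°] with the positive x-axis.
  VeryWide : ℚ → ℚ → Set
  VeryWide m t = (m < 0ℚ) × (0ℚ < m * m + m * m + m * m - t * t)

  neg⇒< : 0ℚ < - x → x < 0ℚ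
  neg⇒< {x} h = subst (_< 0ℚ) (solve 1 (λ x → :- (:- x) := x) refl x) (neg-antimono-< h)

  -- The angles lie in (90°, 180°] and (60°, 90°], so their sum exceeds 150°; the sign of the
  -- imaginary part `p * s + q * r` keeps it at most 180°.
  obtuse*steep : p < 0ℚ → 0ℚ ≤ q → 0ℚ ≤ r → 0ℚ ≤ s → 0ℚ < s * s - (r * r + r * r + r * r) →
                 0ℚ ≤ p * s + q * r → VeryWide (p * r - q * s) (p * s + q * r)
  obtuse*steep {p} {q} {r} {s} p<0 q≥0 r≥0 s≥0 β>0 t≥0 = neg⇒< -m>0 , subst (0ℚ <_) id₂ bound
    where
    -p>0 = neg-antimono-< p<0
    s>0 = steep⇒0< {s} {r} s≥0 β>0
    q>0 : 0ℚ < q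
    q>0 = 0<*-cancelʳ r≥0 (subst (0ℚ <_)
      (solve 4 (λ p q r s → (:- p) :* s :+ (p :* s :+ q :* r) := q :* r) refl p q r s)
      (0<+ (0<* -p>0 s>0) t≥0))
    -m>0 : 0ℚ < - (p * r - q * s)
    -m>0 = subst (0ℚ <_)
      (solve 4 (λ p q r s → q :* s :+ (:- p) :* r := :- (p :* r :- q :* s)) refl p q r s)
      (0<+ (0<* q>0 s>0) (0≤* (<⇒≤ -p>0) r≥0))
    prqs = 0≤* (0≤* (<⇒≤ -p>0) r≥0) (<⇒≤ (0<* q>0 s>0))
    pr² = 0≤² (p * r)
    bound = 0<+ (0<* (0<* q>0 q>0) β>0)
      (0≤+ (0≤+ (0≤² (q * s)) (0≤² (q * s)))
      (0≤+ (0≤+ (0≤² (q * r)) (0≤² (q * r)))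
      (0≤+ (0≤* t≥0 (0≤* (<⇒≤ -p>0) s≥0))
      (0≤+ (0≤+ (0≤+ pr² pr²) pr²)
           (0≤+ (0≤+ (0≤+ (0≤+ (0≤+ (0≤+ prqs prqs) prqs) prqs) prqs) prqs) prqs)))))
    id₂ = solve 4 (λ p q r s →
       let m = p :* r :- q :* s; t = p :* s :+ q :* r
           e = (:- p) :* r :* (q :* s); pr = p :* r :* (p :* r)
           qs = q :* s :* (q :* s); qr = q :* r :* (q :* r) in
       q :* q :* (s :* s :- (r :* r :+ r :* r :+ r :* r))
         :+ ((qs :+ qs) :+ ((qr :+ qr) :+ (t :* ((:- p) :* s) :+
             ((pr :+ pr :+ pr) :+ (e :+ e :+ e :+ e :+ e :+ e :+ e)))))
         := m :* m :+ m :* m :+ m :* m :- t :* t) refl p q r s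

  -- Two angles in (60°, 90°] add up to one in (120°, 180°].
  steep*steep : 0ℚ ≤ p → 0ℚ ≤ q → 0ℚ < q * q - (p * p + p * p + p * p) →
                0ℚ ≤ r → 0ℚ ≤ s → 0ℚ < s * s - (r * r + r * r + r * r) →
                VeryWide (p * r - q * s) (p * s + q * r)
  steep*steep {p} {q} {r} {s} p≥0 q≥0 α>0 r≥0 s≥0 β>0 = neg⇒< -m>0 , 0<3*⇒0< (subst (0ℚ <_) id₃ bound)
    where
    q>0 = steep⇒0< {q} {p} q≥0 α>0
    s>0 = steep⇒0< {s} {r} s≥0 β>0
    pr≥0 = 0≤* p≥0 r≥0
    p²β = 0≤* (0≤² p) (<⇒≤ β>0)
    -- Multiplying `q > √3 p` by `s > √3 r` gives `q s > 3 p r`; without roots, the difference of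
    -- the squares is factored.
    D>0 : 0ℚ < q * s - (p * r + p * r + p * r)
    D>0 = 0<*-cancelʳ (0≤+ (0≤* q≥0 s≥0) (0≤+ (0≤+ pr≥0 pr≥0) pr≥0)) (subst (0ℚ <_)
      (solve 4 (λ p q r s →
        let e = p :* p :* (s :* s :- (r :* r :+ r :* r :+ r :* r)); pr = p :* r in
        (q :* q :- (p :* p :+ p :* p :+ p :* p)) :* (s :* s) :+ (e :+ e :+ e)
        := (q :* s :- (pr :+ pr :+ pr)) :* (q :* s :+ (pr :+ pr :+ pr))) refl p q r s)
      (0<+ (0<* α>0 (0<* s>0 s>0)) (0≤+ (0≤+ p²β p²β) p²β)))
    -m>0 : 0ℚ < - (p * r - q * s)
    -m>0 = subst (0ℚ <_)
      (solve 4 (λ p q r s → let pr = p :* r in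
        (q :* s :- (pr :+ pr :+ pr)) :+ (pr :+ pr) := :- (pr :- q :* s)) refl p q r s)
      (0<+ D>0 (0≤+ pr≥0 pr≥0))
    qsD = 0≤* (<⇒≤ (0<* q>0 s>0)) (<⇒≤ D>0)
    2qsD = 0≤+ qsD qsD
    4qsD = 0≤+ 2qsD 2qsD
    bound = 0<+ (0<* α>0 β>0) (0≤+ 4qsD 4qsD)
    id₃ = solve 4 (λ p q r s →
       let m = p :* r :- q :* s; t = p :* s :+ q :* r
           pr = p :* r
           e = q :* s :* (q :* s :- (pr :+ pr :+ pr)); e₄ = (e :+ e) :+ (e :+ e)
           z = m :* m :+ m :* m :+ m :* m :- t :* t in
       (q :* q :- (p :* p :+ p :* p :+ p :* p)) :* (s :* s :- (r :* r :+ r :* r :+ r :* r))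
         :+ (e₄ :+ e₄) := z :+ z :+ z) refl p q r s

  -- Two angles above 60° sum to more than 120°, and a `Wide` product means that the sum has not
  -- passed 180°.
  Wide-* : Wide p q → Wide r s → Wide (p * r - q * s) (p * s + q * r) →
           VeryWide (p * r - q * s) (p * s + q * r)
  Wide-* (q≥0 , inj₁ p<0) (s≥0 , inj₁ r<0) w = ⊥-elim (obtuse*obtuse p<0 q≥0 r<0 s≥0 w)
  Wide-* (q≥0 , inj₁ p<0) (s≥0 , inj₂ (r≥0 , β)) (t≥0 , _) = obtuse*steep p<0 q≥0 r≥0 s≥0 β t≥0
  Wide-* {p} {q} {r} {s} (q≥0 , inj₂ (p≥0 , α)) (s≥0 , inj₁ r<0) (t≥0 , _) =
    subst₂ VeryWide eq₁ eq₂
      (obtuse*steep r<0 s≥0 p≥0 q≥0 α (subst (0ℚ ≤_) (sym eq₂) t≥0))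
    where
    eq₁ = solve 4 (λ p q r s → r :* p :- s :* q := p :* r :- q :* s) refl p q r s
    eq₂ = solve 4 (λ p q r s → r :* q :+ s :* p := p :* s :+ q :* r) refl p q r s
  Wide-* (q≥0 , inj₂ (p≥0 , α)) (s≥0 , inj₂ (r≥0 , β)) _ = steep*steep p≥0 q≥0 α r≥0 s≥0 β

  -- An angle above 120° and one above 60°, neither above 180°, sum to an angle in (180°, 360°].
  VeryWide-*-Wide : VeryWide p q → 0ℚ ≤ q → Wide r s → ¬ Wide (p * r - q * s) (p * s + q * r)
  VeryWide-*-Wide (p<0 , _) q≥0 (s≥0 , inj₁ r<0) w = obtuse*obtuse p<0 q≥0 r<0 s≥0 w
  VeryWide-*-Wide {p} {q} {r} {s} (p<0 , α) q≥0 (s≥0 , inj₂ (r≥0 , β)) (t≥0 , _) = 0<⇒≢0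
    (0<+ (0<+ (0<* (0<* -p>0 -p>0) β) (0≤* (0≤² r) (<⇒≤ α)))
         (0≤* t≥0 (0≤+ (0≤* (<⇒≤ -p>0) s≥0) (0≤* q≥0 r≥0))))
    (solve 4 (λ p q r s →
       (:- p) :* (:- p) :* (s :* s :- (r :* r :+ r :* r :+ r :* r))
         :+ r :* r :* (p :* p :+ p :* p :+ p :* p :- q :* q)
         :+ (p :* s :+ q :* r) :* ((:- p) :* s :+ q :* r) := con 0ℚ) refl p q r s)
    where
    -p>0 = neg-antimono-< p<0

  -- Six vectors cannot be pairwise more than 60° apart.

  Vector : Set
  Vector = ℚ × ℚ

  ∥_∥² : Vector → ℚ
  ∥ x , y ∥² = x * x + y * y

  dot det : Vector → Vector → ℚ
  dot (x , y) (x′ , y′) = x * x′ + y * y′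
  det (x , y) (x′ , y′) = x * y′ - y * x′

  _⊖_ : Vector → Vector → Vector
  (x , y) ⊖ (x′ , y′) = x - x′ , y - y′

  Far : Vector → Vector → Set
  Far a b = (∥ a ∥² < ∥ a ⊖ b ∥²) × (∥ b ∥² < ∥ a ⊖ b ∥²)

  -- If 0 ≤ a·b then ∥ a ∥² ∥ b ∥² > 4 (a·b)², which gives (det a b)² > 3 (a·b)², by Lagrange's identity.
  Far⇒Wide : ∀ a b → Far a b → 0ℚ ≤ det a b → Wide (dot a b) (det a b)
  Far⇒Wide a@(x , y) b@(x′ , y′) (fa , fb) det≥0 with dot a b <? 0ℚ
  ... | yes p<0 = det≥0 , inj₁ p<0
  ... | no p≮0 = det≥0 , inj₂ (p≥0 , subst (0ℚ <_)
    (solve 4 (λ x y x′ y′ →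
      let n = x :* x :+ y :* y ; n′ = x′ :* x′ :+ y′ :* y′
          f = (x :- x′) :* (x :- x′) :+ (y :- y′) :* (y :- y′)
          p = x :* x′ :+ y :* y′ ; q = x :* y′ :- y :* x′ in
      ((f :- n′) :+ (p :+ p)) :* (f :- n) :+ (p :+ p) :* (f :- n′)
      := q :* q :- (p :* p :+ p :* p :+ p :* p)) refl x y x′ y′)
    (0<+ (0<* (0<+ (<⇒0<- fb) (0≤+ p≥0 p≥0)) (<⇒0<- fa)) (0≤* (0≤+ p≥0 p≥0) (<⇒≤ (<⇒0<- fb)))))
    where
    p≥0 = ≮⇒≥ p≮0

  Wide-scale : 0ℚ < k → Wide p q → Wide (k * p) (k * q)
  Wide-scale {k} {p} {q} k>0 (q≥0 , inj₁ p<0) = 0≤* (<⇒≤ k>0) q≥0 , inj₁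
    (neg⇒< (subst (0ℚ <_) (solve 2 (λ k p → k :* (:- p) := :- (k :* p)) refl k p)
      (0<* k>0 (neg-antimono-< p<0))))
  Wide-scale {k} {p} {q} k>0 (q≥0 , inj₂ (p≥0 , α)) = 0≤* (<⇒≤ k>0) q≥0 , inj₂
    (0≤* (<⇒≤ k>0) p≥0 , subst (0ℚ <_)
      (solve 3 (λ k p q → let kp = k :* p in
         k :* k :* (q :* q :- (p :* p :+ p :* p :+ p :* p))
         := k :* q :* (k :* q) :- (kp :* kp :+ kp :* kp :+ kp :* kp)) refl k p q)
      (0<* (0<* k>0 k>0) α))

  0<-* : x < 0ℚ → y < 0ℚ → 0ℚ < x * y
  0<-* {x} {y} x<0 y<0 = subst (0ℚ <_) (solve 2 (λ x y → (:- x) :* (:- y) := x :* y) refl x y)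
    (0<* (neg-antimono-< x<0) (neg-antimono-< y<0))

  -- The chain identities carry a factor `∥ b ∥²`; being positive, it leaves angles unchanged.
  Far⇒0< : ∀ a b → Far a b → 0ℚ < ∥ b ∥²
  Far⇒0< a@(x , y) b@(x′ , y′) (fa , _) with dot a b <? 0ℚ
  ... | yes p<0 = 0<*-cancelʳ (0≤+ (0≤² x) (0≤² y)) (subst (0ℚ <_)
    (solve 4 (λ x y x′ y′ →
      let p = x :* x′ :+ y :* y′ ; q = x :* y′ :- y :* x′ in
      p :* p :+ q :* q := (x′ :* x′ :+ y′ :* y′) :* (x :* x :+ y :* y)) refl x y x′ y′)
    (0<+ (0<-* p<0 p<0) (0≤² (det a b))))
  ... | no p≮0 = subst (0ℚ <_)
    (solve 4 (λ x y x′ y′ →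
      let f = (x :- x′) :* (x :- x′) :+ (y :- y′) :* (y :- y′)
          p = x :* x′ :+ y :* y′ in
      (f :- (x :* x :+ y :* y)) :+ (p :+ p) := x′ :* x′ :+ y′ :* y′) refl x y x′ y′)
    (0<+ (<⇒0<- fa) (0≤+ (≮⇒≥ p≮0) (≮⇒≥ p≮0)))

  -- The complex number dot a b + i det a b is ā b, so its arguments add up along a chain.
  dot-chain : ∀ a b c → dot a b * dot b c - det a b * det b c ≡ ∥ b ∥² * dot a c
  dot-chain (x₁ , y₁) (x₂ , y₂) (x₃ , y₃) =
    solve 6 (λ x₁ y₁ x₂ y₂ x₃ y₃ →
      (x₁ :* x₂ :+ y₁ :* y₂) :* (x₂ :* x₃ :+ y₂ :* y₃) :- (x₁ :* y₂ :- y₁ :* x₂) :* (x₂ :* y₃ :- y₂ :* x₃)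
      := (x₂ :* x₂ :+ y₂ :* y₂) :* (x₁ :* x₃ :+ y₁ :* y₃)) refl x₁ y₁ x₂ y₂ x₃ y₃

  det-chain : ∀ a b c → dot a b * det b c + det a b * dot b c ≡ ∥ b ∥² * det a c
  det-chain (x₁ , y₁) (x₂ , y₂) (x₃ , y₃) =
    solve 6 (λ x₁ y₁ x₂ y₂ x₃ y₃ →
      (x₁ :* x₂ :+ y₁ :* y₂) :* (x₂ :* y₃ :- y₂ :* x₃) :+ (x₁ :* y₂ :- y₁ :* x₂) :* (x₂ :* x₃ :+ y₂ :* y₃)
      := (x₂ :* x₂ :+ y₂ :* y₂) :* (x₁ :* y₃ :- y₁ :* x₃)) refl x₁ y₁ x₂ y₂ x₃ y₃

  -- The turns from `a` to `b`, `b` to `c` and `c` to `d` each exceed 60°. The first two together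
  -- stay within 180°, because `c` is to the left of `a`; the third then goes past 180°, so `d`
  -- cannot be to the left of `a` as well.
  no-chain : ∀ a b c d → Far a b → Far b c → Far c d → Far a c → Far a d →
             0ℚ ≤ det a b → 0ℚ ≤ det b c → 0ℚ ≤ det c d → 0ℚ ≤ det a c → ¬ (0ℚ ≤ det a d)
  no-chain a b c d fab fbc fcd fac fad ab bc cd ac ad =
    VeryWide-*-Wide veryWide (proj₁ scaled) (Far⇒Wide c d fcd cd)
      (subst₂ Wide
        (trans (cong (B *_) (sym (dot-chain a c d))) (distrib₁ B _ _ _ _))
        (trans (cong (B *_) (sym (det-chain a c d))) (distrib₂ B _ _ _ _))
        -- The product of the three turns is the turn from `a` to `d`, scaled by the squared lengths
        -- of `b` and `c`.
        (Wide-scale B>0 (Wide-scale (Far⇒0< a c fac) (Far⇒Wide a d fad ad))))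
    where
    B = ∥ b ∥²
    B>0 = Far⇒0< a b fab

    scaled : Wide (B * dot a c) (B * det a c)
    scaled = Wide-scale B>0 (Far⇒Wide a c fac ac)

    veryWide : VeryWide (B * dot a c) (B * det a c)
    veryWide = subst₂ VeryWide (dot-chain a b c) (det-chain a b c)
      (Wide-* (Far⇒Wide a b fab ab) (Far⇒Wide b c fbc bc)
        (subst₂ Wide (sym (dot-chain a b c)) (sym (det-chain a b c)) scaled))

    distrib₁ : ∀ k p q r s → k * (p * r - q * s) ≡ (k * p) * r - (k * q) * s
    distrib₁ = solve 5 (λ k p q r s → k :* (p :* r :- q :* s) := (k :* p) :* r :- (k :* q) :* s) refl

    distrib₂ : ∀ k p q r s → k * (p * s + q * r) ≡ (k * p) * s + (k * q) * r
    distrib₂ = solve 5 (λ k p q r s → k :* (p :* s :+ q :* r) := (k :* p) :* s :+ (k :* q) :* r) refl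

  det-antisym : ∀ a b → det b a ≡ - det a b
  det-antisym (x , y) (x′ , y′) = solve 4 (λ x y x′ y′ → x′ :* y :- y′ :* x := :- (x :* y′ :- y :* x′)) refl x y x′ y′

  det-total : ∀ a b → 0ℚ ≤ det a b ⊎ 0ℚ ≤ det b a
  det-total a b with ≤-total 0ℚ (det a b)
  ... | inj₁ ab = inj₁ ab
  ... | inj₂ ab = inj₂ (subst (0ℚ ≤_) (sym (det-antisym a b)) (neg-antimono-≤ ab))

  Far-sym : ∀ a b → Far a b → Far b a
  Far-sym a@(x , y) b@(x′ , y′) (fa , fb) = subst (∥ b ∥² <_) eq fb , subst (∥ a ∥² <_) eq fa
    where
    eq = solve 4 (λ x y x′ y′ → (x :- x′) :* (x :- x′) :+ (y :- y′) :* (y :- y′)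
                              := (x′ :- x) :* (x′ :- x) :+ (y′ :- y) :* (y′ :- y)) refl x y x′ y′

  -- Every tournament on three vertices has a Hamiltonian path: the signs of the pairwise
  -- determinants always allow an order of `b`, `c`, `d` in which each next vector is to the left of
  -- the previous one.
  no-three-left : ∀ a b c d → AllPairs Far (a ∷ b ∷ c ∷ d ∷ []) → ¬ All (λ v → 0ℚ ≤ det a v) (b ∷ c ∷ d ∷ [])
  no-three-left a b c d ((ab ∷ ac ∷ ad ∷ []) ∷ (bc ∷ bd ∷ []) ∷ (cd ∷ []) ∷ [] ∷ []) (b≥0 ∷ c≥0 ∷ d≥0 ∷ [])
    with det-total b c | det-total c d | det-total b d
  ... | inj₁ bc≥0 | inj₁ cd≥0 | _         = no-chain a b c d ab bc cd ac ad b≥0 bc≥0 cd≥0 c≥0 d≥0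
  ... | inj₂ cb≥0 | inj₂ dc≥0 | _         = no-chain a d c b ad dc cb ac ab d≥0 dc≥0 cb≥0 c≥0 b≥0
    where dc = Far-sym c d cd; cb = Far-sym b c bc
  ... | inj₁ bc≥0 | inj₂ dc≥0 | inj₁ bd≥0 = no-chain a b d c ab bd (Far-sym c d cd) ad ac b≥0 bd≥0 dc≥0 d≥0 c≥0
  ... | inj₁ bc≥0 | inj₂ dc≥0 | inj₂ db≥0 = no-chain a d b c ad (Far-sym b d bd) bc ab ac d≥0 db≥0 bc≥0 b≥0 c≥0
  ... | inj₂ cb≥0 | inj₁ cd≥0 | inj₁ bd≥0 = no-chain a c b d ac (Far-sym b c bc) bd ab ad c≥0 cb≥0 bd≥0 b≥0 d≥0
  ... | inj₂ cb≥0 | inj₁ cd≥0 | inj₂ db≥0 = no-chain a c d b ac cd (Far-sym b d bd) ad ab c≥0 cd≥0 db≥0 d≥0 b≥0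

  reflect : Vector → Vector
  reflect (x , y) = x , - y

  ∥reflect∥ : ∀ a → ∥ reflect a ∥² ≡ ∥ a ∥²
  ∥reflect∥ (x , y) = solve 2 (λ x y → x :* x :+ (:- y) :* (:- y) := x :* x :+ y :* y) refl x y

  ∥reflect⊖∥ : ∀ a b → ∥ reflect a ⊖ reflect b ∥² ≡ ∥ a ⊖ b ∥²
  ∥reflect⊖∥ (x , y) (x′ , y′) = solve 4 (λ x y x′ y′ →
    (x :- x′) :* (x :- x′) :+ ((:- y) :- (:- y′)) :* ((:- y) :- (:- y′))
    := (x :- x′) :* (x :- x′) :+ (y :- y′) :* (y :- y′)) refl x y x′ y′

  Far-reflect : ∀ a b → Far a b → Far (reflect a) (reflect b)
  Far-reflect a b (fa , fb) =
    subst₂ _<_ (sym (∥reflect∥ a)) (sym (∥reflect⊖∥ a b)) fa ,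
    subst₂ _<_ (sym (∥reflect∥ b)) (sym (∥reflect⊖∥ a b)) fb

  det-reflect : ∀ a b → det a b ≤ 0ℚ → 0ℚ ≤ det (reflect a) (reflect b)
  det-reflect (x , y) (x′ , y′) ab = subst (0ℚ ≤_)
    (solve 4 (λ x y x′ y′ → :- (x :* y′ :- y :* x′) := x :* (:- y′) :- (:- y) :* x′) refl x y x′ y′)
    (neg-antimono-≤ ab)

  -- Reflection in the x-axis keeps lengths and distances and negates determinants, which exchanges
  -- left and right.
  no-three-right : ∀ a b c d → AllPairs Far (a ∷ b ∷ c ∷ d ∷ []) → ¬ All (λ v → det a v ≤ 0ℚ) (b ∷ c ∷ d ∷ [])
  no-three-right a b c d fars signs = no-three-left (reflect a) (reflect b) (reflect c) (reflect d)
    (AllPairs.map⁺ (AllPairs.map (λ {v} {w} → Far-reflect v w) fars))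
    (All.map⁺ (All.map (λ {v} → det-reflect a v) signs))

  length-filter-¬ : ∀ {A : Set} {P : A → Set} (P? : ∀ x → Dec (P x)) xs →
                    length (filter P? xs) ℕ.+ length (filter (¬? ∘ P?) xs) ≡ length xs
  length-filter-¬ P? []       = refl
  length-filter-¬ P? (x ∷ xs) with P? x
  ... | yes _ = cong suc (length-filter-¬ P? xs)
  ... | no  _ = trans (ℕₚ.+-suc _ _) (cong suc (length-filter-¬ P? xs))

  three-of : ∀ {P : Vector → Set} {a} →
             (∀ b c d → AllPairs Far (a ∷ b ∷ c ∷ d ∷ []) → ¬ All P (b ∷ c ∷ d ∷ [])) →
             ∀ {vs} → 3 ℕ.≤ length vs → All (Far a) vs → AllPairs Far vs → ¬ All P vs
  three-of none {b ∷ c ∷ d ∷ _} _ (ab ∷ ac ∷ ad ∷ _) ((bc ∷ bd ∷ _) ∷ (cd ∷ _) ∷ _) (pb ∷ pc ∷ pd ∷ _) =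
    none b c d ((ab ∷ ac ∷ ad ∷ []) ∷ (bc ∷ bd ∷ []) ∷ (cd ∷ []) ∷ [] ∷ []) (pb ∷ pc ∷ pd ∷ [])
  three-of none {_ ∷ []} (s≤s ())
  three-of none {_ ∷ _ ∷ []} (s≤s (s≤s ()))

  no-six-far : ∀ vs → 6 ℕ.≤ length vs → ¬ AllPairs Far vs
  no-six-far (a ∷ vs) (s≤s len) (far ∷ fars) with 3 ℕₚ.≤? length (filter (λ v → 0ℚ ≤? det a v) vs)
  ... | yes 3≤ = three-of (no-three-left a) 3≤
                   (All.filter⁺ L? far) (AllPairs.filter⁺ L? fars) (All.all-filter L? vs)
    where
    L? = λ v → 0ℚ ≤? det a v
  ... | no 3≰ = three-of (no-three-right a) 3≤ (All.filter⁺ (¬? ∘ L?) far) (AllPairs.filter⁺ (¬? ∘ L?) fars)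
                  (All.map (λ v≱0 → <⇒≤ (≰⇒> v≱0)) (All.all-filter (¬? ∘ L?) vs))
    where
    L? = λ v → 0ℚ ≤? det a v
    3≤ : 3 ℕ.≤ length (filter (¬? ∘ L?) vs)
    -- At most two of at least five vectors are on the left, so at least three are not.
    3≤ = ℕₚ.+-cancelˡ-≤ 2 3 _ (ℕₚ.≤-trans (subst (5 ℕ.≤_) (sym (length-filter-¬ L? vs)) len)
           (ℕₚ.+-monoˡ-≤ _ (ℕ.s≤s⁻¹ (ℕₚ.≰⇒> 3≰))))

  -- From Cauchy reals to rational approximations.

  -- Asking for all `δ ≤ ε` makes the property persist when `ε` shrinks, so finitely many such
  -- properties share one `ε` and one `N`.
  Eventually : (ℚ → ℕ → Set) → Set
  Eventually P = Σ[ ε ∈ ℚ ] (0ℚ < ε) × ∃[ N ] (∀ δ i → δ ≤ ε → N ℕ.≤ i → P δ i)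

  Eventually-× : ∀ {P Q} → Eventually P → Eventually Q → Eventually (λ ε i → P ε i × Q ε i)
  Eventually-× (ε , ε>0 , M , p) (δ , δ>0 , N , q) = ε ℚ.⊓ δ , ⊓>0 , M ℕ.⊔ N , λ η i η≤ i≥ →
    p η i (≤-trans η≤ (p⊓q≤p ε δ)) (ℕₚ.m⊔n≤o⇒m≤o M N i≥) ,
    q η i (≤-trans η≤ (p⊓q≤q ε δ)) (ℕₚ.m⊔n≤o⇒n≤o M N i≥)
    where
    ⊓>0 : 0ℚ < ε ℚ.⊓ δ
    ⊓>0 with ⊓-sel ε δ
    ... | inj₁ eq = subst (0ℚ <_) (sym eq) ε>0
    ... | inj₂ eq = subst (0ℚ <_) (sym eq) δ>0

  Eventually-const : ∀ {P : ℚ → ℕ → Set} → (∀ ε i → P ε i) → Eventually P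
  Eventually-const p = 1ℚ , positive⁻¹ 1ℚ , 0 , λ ε i _ _ → p ε i

  Eventually-map : ∀ {P Q : ℚ → ℕ → Set} → (∀ ε i → P ε i → Q ε i) → Eventually P → Eventually Q
  Eventually-map f (ε , ε>0 , N , p) = ε , ε>0 , N , λ δ i δ≤ i≥ → f δ i (p δ i δ≤ i≥)

  module _ {A : Set} where

    -- Double negation commutes with finite conjunctions, so all witnesses are available at once
    -- while a contradiction is being derived.
    ¬¬-Eventually-All : ∀ {P : A → ℚ → ℕ → Set} {xs} → All (λ x → ¬ ¬ Eventually (P x)) xs →
                        ¬ ¬ Eventually (λ ε i → All (λ x → P x ε i) xs)
    ¬¬-Eventually-All []         k = k (Eventually-const (λ _ _ → []))
    ¬¬-Eventually-All (px ∷ pxs) k = px λ e → ¬¬-Eventually-All pxs λ es →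
      k (Eventually-map (λ _ _ (p , ps) → p ∷ ps) (Eventually-× e es))

    ¬¬-Eventually-AllPairs : ∀ {R : A → A → ℚ → ℕ → Set} {xs} → AllPairs (λ x y → ¬ ¬ Eventually (R x y)) xs →
                             ¬ ¬ Eventually (λ ε i → AllPairs (λ x y → R x y ε i) xs)
    ¬¬-Eventually-AllPairs []         k = k (Eventually-const (λ _ _ → []))
    ¬¬-Eventually-AllPairs (px ∷ pxs) k = ¬¬-Eventually-All px λ e → ¬¬-Eventually-AllPairs pxs λ es →
      k (Eventually-map (λ _ _ (p , ps) → p ∷ ps) (Eventually-× e es))

  p≤∣p∣ : ∀ p → p ≤ ℚ.∣ p ∣
  p≤∣p∣ p with ≤-total 0ℚ p
  ... | inj₁ p≥0 = ≤-reflexive (sym (0≤p⇒∣p∣≡p p≥0))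
  ... | inj₂ p≤0 = ≤-trans p≤0 (0≤∣p∣ p)

  ½+½ : ∀ ε → ½ * ε + ½ * ε ≡ ε
  ½+½ ε = trans (sym (*-distribʳ-+ ε ½ ½)) (*-identityˡ ε)

  -- ¬ (x ≤ 1) yields 1 < x only up to double negation, as Markov's principle is not available.
  ≰ᴿ1⇒¬¬Eventually : ∀ x → ¬ (x ≤ᴿ 1ᴿ) → ¬ ¬ Eventually (λ ε i → 1ℚ + ε < seq x i)
  ≰ᴿ1⇒¬¬Eventually x x≰1 k = x≰1 λ ε ε>0 →
    let N , close = cauchy x (½ * ε) (0<* (positive⁻¹ ½) ε>0)
    in N , bound ε ε>0 N close
    where
    bound : ∀ ε → 0ℚ < ε → ∀ N → (∀ i j → N ℕ.≤ i → N ℕ.≤ j → ℚ.∣ seq x i - seq x j ∣ < ½ * ε) →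
            ∀ i → N ℕ.≤ i → seq x i ≤ 1ℚ + ε
    bound ε ε>0 N close i i≥ with seq x i ≤? 1ℚ + ε
    ... | yes x≤ = x≤
    -- One late term above `1 + ε` keeps every late term above `1 + ε / 2` by the Cauchy property,
    -- and `k` refutes this.
    ... | no  x≰ = ⊥-elim (k (½ * ε , 0<* (positive⁻¹ ½) ε>0 , N , λ δ j δ≤ j≥ → 0<-⇒< (far δ j δ≤ j≥)))
      where
      far : ∀ δ j → δ ≤ ½ * ε → N ℕ.≤ j → 0ℚ < seq x j - (1ℚ + δ)
      far δ j δ≤ j≥ = subst (0ℚ <_)
        (solve 5 (λ a b h δ o →
           a :- (o :+ (h :+ h)) :+ (h :- (a :- b)) :+ (h :- δ) := b :- (o :+ δ))
           refl (seq x i) (seq x j) (½ * ε) δ 1ℚ)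
        (0<+ (0<+ (subst (λ e → 0ℚ < seq x i - (1ℚ + e)) (sym (½+½ ε)) (<⇒0<- (≰⇒> x≰)))
                  (<⇒≤ (<⇒0<- (≤-<-trans (p≤∣p∣ _) (close i j i≥ j≥)))))
             (subst (_≤ ½ * ε - δ) (+-inverseʳ δ) (+-monoˡ-≤ (- δ) δ≤)))

  ⊖-cancelʳ : ∀ a b c → (a ⊖ c) ⊖ (b ⊖ c) ≡ a ⊖ b
  ⊖-cancelʳ (a₁ , a₂) (b₁ , b₂) (c₁ , c₂) = cong₂ _,_ (eq a₁ b₁ c₁) (eq a₂ b₂ c₂)
    where
    eq : ∀ a b c → (a - c) - (b - c) ≡ a - b
    eq = solve 3 (λ a b c → (a :- c) :- (b :- c) := a :- b) refl

  AllPairs-zipAll : ∀ {A : Set} {P : A → Set} {R : A → A → Set} {xs} → All P xs → AllPairs R xs →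
                    AllPairs (λ x y → P x × P y × R x y) xs
  AllPairs-zipAll [] [] = []
  AllPairs-zipAll (px ∷ pxs) (rx ∷ rs) = All.zipWith (λ (py , r) → px , py , r) (pxs , rx) ∷ AllPairs-zipAll pxs rs

  far-apart : ∀ {a b c : Vector} {r} → ∥ a ⊖ c ∥² ≤ r → ∥ b ⊖ c ∥² ≤ r → r < ∥ a ⊖ b ∥² → Far (a ⊖ c) (b ⊖ c)
  far-apart {a} {b} {c} a-near b-near ab-far =
    subst (λ d → ∥ a ⊖ c ∥² < ∥ d ∥²) (sym (⊖-cancelʳ a b c)) (≤-<-trans a-near ab-far) ,
    subst (λ d → ∥ b ⊖ c ∥² < ∥ d ∥²) (sym (⊖-cancelʳ a b c)) (≤-<-trans b-near ab-far)

  -- Independent neighbours in a unit disk graph.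

  module _ {n} (G : Graph n) (unitDisk : IsUnitDisk G) where
    open Graph G

    private
      pos = proj₁ unitDisk
      ~⇒near : ∀ {u v} → u ≢ v → u ~ v → dist² (pos u) (pos v) ≤ᴿ 1ᴿ
      ~⇒near {u} {v} u≢v = Equivalence.to (proj₂ unitDisk u v u≢v)
      near⇒~ : ∀ {u v} → u ≢ v → dist² (pos u) (pos v) ≤ᴿ 1ᴿ → u ~ v
      near⇒~ {u} {v} u≢v = Equivalence.from (proj₂ unitDisk u v u≢v)

      at : ℕ → Fin n → Vector
      at i v = seq (proj₁ (pos v)) i , seq (proj₂ (pos v)) i

    near-all : ∀ {v ws} → All (v ~_) ws → ∀ {ε} → 0ℚ < ε →
               ∃[ N ] (∀ i → N ℕ.≤ i → All (λ w → ∥ at i w ⊖ at i v ∥² ≤ 1ℚ + ε) ws)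
    near-all [] ε>0 = 0 , λ _ _ → []
    near-all {v} (_∷_ {w} v~w v~ws) ε>0 =
      let M , p = ~⇒near (λ { refl → irrefl refl v~w }) (symm v~w) _ ε>0
          N , q = near-all v~ws ε>0
      in M ℕ.⊔ N , λ i i≥ → p i (ℕₚ.m⊔n≤o⇒m≤o M N i≥) ∷ q i (ℕₚ.m⊔n≤o⇒n≤o M N i≥)

    far-all : ∀ {ws} → AllPairs (λ x y → x ≢ y × ¬ (x ~ y)) ws →
              ¬ ¬ Eventually (λ ε i → AllPairs (λ x y → 1ℚ + ε < ∥ at i x ⊖ at i y ∥²) ws)
    far-all apart = ¬¬-Eventually-AllPairs
      (AllPairs.map (λ {x} {y} (x≢y , x≁y) → ≰ᴿ1⇒¬¬Eventually (dist² (pos x) (pos y)) (x≁y ∘ near⇒~ x≢y)) apart)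

    -- At a late index, the approximate positions relative to `v` would be at least six vectors that
    -- are pairwise `Far`.
    no-six-independent-neighbours : ∀ {v} ws → 6 ℕ.≤ length ws → All (v ~_) ws →
                                    ¬ AllPairs (λ x y → x ≢ y × ¬ (x ~ y)) ws
    no-six-independent-neighbours {v} ws 6≤ v~ws apart = far-all apart
      λ (ε , ε>0 , M , far) →
        -- The non-adjacent pairs fix `ε` first; the neighbours are then within squared distance
        -- `1 + ε` of `v` from some index on, so the same number separates the two kinds of
        -- distances.
        let N , near = near-all v~ws ε>0
            i = M ℕ.⊔ N
        in no-six-far (map (λ w → at i w ⊖ at i v) ws)
             (subst (6 ℕ.≤_) (sym (List.length-map _ ws)) 6≤)
             (AllPairs.map⁺ (AllPairs.map
               (λ {x} {y} (x-near , y-near , xy-far) → far-apart {at i x} {at i y} {at i v} x-near y-near xy-far)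
               (AllPairs-zipAll (near i (ℕₚ.m≤n⊔m M N)) (far ε i ≤-refl (ℕₚ.m≤m⊔n M N)))))

-- Rational approximation factors from inequalities between natural numbers.

module Ratio where

  open import Data.Integer as ℤ using (+_)
  import Data.Integer.Properties as ℤₚ
  open import Data.Rational using (_/_; fromℚᵘ)
  open import Data.Rational.Properties
  open import Data.Rational.Solver using (module +-*-Solver)
  open import Data.Rational.Unnormalised as ℚᵘ using (mkℚᵘ; *≡*)
  import Data.Rational.Unnormalised.Properties as ℚᵘₚ
  open +-*-Solver

  fromℚᵘ-homo-+ : ∀ p q → fromℚᵘ p ℚ.+ fromℚᵘ q ≡ fromℚᵘ (p ℚᵘ.+ q)
  fromℚᵘ-homo-+ p q = toℚᵘ-injective (ℚᵘₚ.≃-trans (toℚᵘ-homo-+ (fromℚᵘ p) (fromℚᵘ q))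
    (ℚᵘₚ.≃-trans (ℚᵘₚ.+-cong (toℚᵘ-fromℚᵘ p) (toℚᵘ-fromℚᵘ q)) (ℚᵘₚ.≃-sym (toℚᵘ-fromℚᵘ (p ℚᵘ.+ q)))))

  fromℚᵘ-homo-* : ∀ p q → fromℚᵘ p ℚ.* fromℚᵘ q ≡ fromℚᵘ (p ℚᵘ.* q)
  fromℚᵘ-homo-* p q = toℚᵘ-injective (ℚᵘₚ.≃-trans (toℚᵘ-homo-* (fromℚᵘ p) (fromℚᵘ q))
    (ℚᵘₚ.≃-trans (ℚᵘₚ.*-cong (toℚᵘ-fromℚᵘ p) (toℚᵘ-fromℚᵘ q)) (ℚᵘₚ.≃-sym (toℚᵘ-fromℚᵘ (p ℚᵘ.* q)))))

  fromℕ : ℕ → ℚ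
  fromℕ k = + k / 1

  fromℕ-homo-+ : ∀ a b → fromℕ (a ℕ.+ b) ≡ fromℕ a ℚ.+ fromℕ b
  fromℕ-homo-+ a b = sym (trans (fromℚᵘ-homo-+ (mkℚᵘ (+ a) 0) (mkℚᵘ (+ b) 0))
    (fromℚᵘ-cong {mkℚᵘ (+ a) 0 ℚᵘ.+ mkℚᵘ (+ b) 0} {mkℚᵘ (+ (a ℕ.+ b)) 0}
      (*≡* (cong (ℤ._* + 1) (cong₂ ℤ._+_ (ℤₚ.*-identityʳ (+ a)) (ℤₚ.*-identityʳ (+ b)))))))

  fromℕ-homo-* : ∀ a b → fromℕ (a ℕ.* b) ≡ fromℕ a ℚ.* fromℕ b
  fromℕ-homo-* a b = sym (trans (fromℚᵘ-homo-* (mkℚᵘ (+ a) 0) (mkℚᵘ (+ b) 0))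
    (fromℚᵘ-cong {mkℚᵘ (+ a) 0 ℚᵘ.* mkℚᵘ (+ b) 0} {mkℚᵘ (+ (a ℕ.* b)) 0}
      (*≡* (cong (ℤ._* + 1) (sym (ℤₚ.pos-* a b))))))

  fromℕ-*-/ : ∀ k m .{{_ : NonZero m}} → fromℕ m ℚ.* (+ k / m) ≡ fromℕ k
  fromℕ-*-/ k m@(suc m-1) = trans (fromℚᵘ-homo-* (mkℚᵘ (+ m) 0) (mkℚᵘ (+ k) m-1))
    (fromℚᵘ-cong {mkℚᵘ (+ m) 0 ℚᵘ.* mkℚᵘ (+ k) m-1} {mkℚᵘ (+ k) 0}
      (*≡* (trans (ℤₚ.*-identityʳ (+ m ℤ.* + k)) (trans (ℤₚ.*-comm (+ m) (+ k)) (cong (+ k ℤ.*_) (sym (ℤₚ.*-identityˡ (+ m))))))))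

  fromℕ-mono-≤ : ∀ {a b} → a ℕ.≤ b → fromℕ a ℚ.≤ fromℕ b
  fromℕ-mono-≤ {a} a≤b with ℕₚ.m≤n⇒∃[o]m+o≡n a≤b
  ... | d , refl = subst₂ ℚ._≤_ (+-identityʳ (fromℕ a)) (sym (fromℕ-homo-+ a d))
    (+-monoʳ-≤ (fromℕ a) (nonNegative⁻¹ (fromℕ d) {{normalize-nonNeg d 1}}))

  module _ (m : ℕ) .{{_ : NonZero m}} {t o : ℕ} where

    private
      q₃₅ = + 35 / m
      q₅ = + 5 / m
      instance
        m-pos : ℚ.Positive (fromℕ m)
        m-pos = normalize-pos m 1

    -- Multiplication by `m` clears the denominator.
    ratio-light : m ℕ.* t ℕ.≤ (5 ℕ.* m ℕ.+ 35) ℕ.* o → fromℕ t ℚ.≤ (fromℕ 5 ℚ.+ + 35 / m) ℚ.* fromℕ o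
    ratio-light h = *-cancelˡ-≤-pos (fromℕ m) (subst₂ ℚ._≤_ (fromℕ-homo-* m t) eq (fromℕ-mono-≤ h))
      where
      eq : fromℕ ((5 ℕ.* m ℕ.+ 35) ℕ.* o) ≡ fromℕ m ℚ.* ((fromℕ 5 ℚ.+ q₃₅) ℚ.* fromℕ o)
      eq = trans (fromℕ-homo-* (5 ℕ.* m ℕ.+ 35) o) (trans
        (cong (ℚ._* fromℕ o) (trans (fromℕ-homo-+ (5 ℕ.* m) 35)
          (cong₂ ℚ._+_ (fromℕ-homo-* 5 m) (sym (fromℕ-*-/ 35 m)))))
        (solve 4 (λ a m q o → (a :* m :+ m :* q) :* o := m :* ((a :+ q) :* o)) refl (fromℕ 5) (fromℕ m) q₃₅ (fromℕ o)))

    -- The subtracted term of the factor stands as `5 o` on the left of the hypothesis, to stay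
    -- within the natural numbers, and is moved over here.
    ratio-heavy : m ℕ.* t ℕ.+ 5 ℕ.* o ℕ.≤ 13 ℕ.* m ℕ.* o → fromℕ t ℚ.≤ (fromℕ 13 ℚ.- + 5 / m) ℚ.* fromℕ o
    ratio-heavy h = *-cancelˡ-≤-pos (fromℕ m) (subst₂ ℚ._≤_ eq₁ eq₂
      (+-monoˡ-≤ (ℚ.- (fromℕ 5 ℚ.* fromℕ o)) (subst₂ ℚ._≤_ eq₃ eq₄ (fromℕ-mono-≤ h))))
      where
      eq₃ : fromℕ (m ℕ.* t ℕ.+ 5 ℕ.* o) ≡ fromℕ m ℚ.* fromℕ t ℚ.+ fromℕ 5 ℚ.* fromℕ o
      eq₃ = trans (fromℕ-homo-+ (m ℕ.* t) (5 ℕ.* o)) (cong₂ ℚ._+_ (fromℕ-homo-* m t) (fromℕ-homo-* 5 o))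

      eq₄ : fromℕ (13 ℕ.* m ℕ.* o) ≡ fromℕ 13 ℚ.* fromℕ m ℚ.* fromℕ o
      eq₄ = trans (fromℕ-homo-* (13 ℕ.* m) o) (cong (ℚ._* fromℕ o) (fromℕ-homo-* 13 m))

      eq₁ : fromℕ m ℚ.* fromℕ t ℚ.+ fromℕ 5 ℚ.* fromℕ o ℚ.- fromℕ 5 ℚ.* fromℕ o ≡ fromℕ m ℚ.* fromℕ t
      eq₁ = solve 2 (λ x y → x :+ y :- y := x) refl (fromℕ m ℚ.* fromℕ t) (fromℕ 5 ℚ.* fromℕ o)

      eq₂ : fromℕ 13 ℚ.* fromℕ m ℚ.* fromℕ o ℚ.- fromℕ 5 ℚ.* fromℕ o ≡ fromℕ m ℚ.* ((fromℕ 13 ℚ.- q₅) ℚ.* fromℕ o)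
      eq₂ = trans (cong (λ f → fromℕ 13 ℚ.* fromℕ m ℚ.* fromℕ o ℚ.- f ℚ.* fromℕ o) (sym (fromℕ-*-/ 5 m)))
        (solve 4 (λ a m q o → a :* m :* o :- (m :* q) :* o := m :* ((a :- q) :* o)) refl (fromℕ 13) (fromℕ m) q₅ (fromℕ o))

open import Data.Nat using (ℕ; zero; suc; s≤s; z≤n; NonZero; _+_; _*_; _≤_; _<_; _≤?_; _<?_)
open import Data.Nat.Properties hiding (_≟_; _≤?_; _<?_)
open import Data.Nat.Solver using (module +-*-Solver)
open import Data.Fin.Subset using (Subset; inside; outside; _∈_; _∉_; _⊆_; _⊂_; _∪_; _∩_; _─_; _-_; ⊥; ⁅_⁆; ∣_∣; Nonempty; Empty)
open import Data.Fin.Subset.Properties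
open import Relation.Binary.Construct.Closure.ReflexiveTransitive using (Star; ε; _◅_; _◅◅_; gmap; reverse)
open import Algebra.Properties.CommutativeMonoid.Sum +-0-commutativeMonoid using (sum; ∑-comm)

-- Cardinalities of finite sets and double counting.

module Counting where

  private variable
    n k m : ℕ
    x y v : Fin n
    p q : Subset n

  module _ {P : Pred.Pred (Fin n) 0ℓ} (P? : Pred.Decidable P) where

    ∈⟪⟫⁺ : P v → v ∈ ⟪ P? ⟫
    ∈⟪⟫⁺ {v} pv = Vec.lookup⇒[]= v _ (trans (Vec.lookup∘tabulate _ v) (dec-true (P? v) pv))

    ∈⟪⟫⁻ : v ∈ ⟪ P? ⟫ → P v
    ∈⟪⟫⁻ {v} v∈ with P? v | trans (sym (Vec.lookup∘tabulate (does ∘ P?) v)) (Vec.[]=⇒lookup v∈)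
    ... | yes pv | _ = pv
    ... | no _   | ()

  x∈p─q⇒x∉q : x ∈ p ─ q → x ∉ q
  x∈p─q⇒x∉q {p = _ ∷ _} {q = inside  ∷ _} ()         here
  x∈p─q⇒x∉q {p = _ ∷ _} {q = inside  ∷ _} (there x∈) (there x∈q) = x∈p─q⇒x∉q x∈ x∈q
  x∈p─q⇒x∉q {p = _ ∷ _} {q = outside ∷ _} (there x∈) (there x∈q) = x∈p─q⇒x∉q x∈ x∈q

  x∈p-y⇒x∈p : x ∈ p - y → x ∈ p
  x∈p-y⇒x∈p {p = p} {y} = p─q⊆p p ⁅ y ⁆

  x∈p-y⇒x≢y : x ∈ p - y → x ≢ y
  x∈p-y⇒x≢y {x = x} {p = p} x∈ refl = x∈p─q⇒x∉q {p = p} x∈ (x∈⁅x⁆ x)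

  -‿mono : p ⊆ q → p - y ⊆ q - y
  -‿mono {p = p} p⊆q x∈ = x∈p∧x≢y⇒x∈p-y (p⊆q (x∈p-y⇒x∈p x∈)) (x∈p-y⇒x≢y {p = p} x∈)

  x∈p⇒0<∣p∣ : x ∈ p → 0 < ∣ p ∣
  x∈p⇒0<∣p∣ x∈p = ≤-trans (s≤s z≤n) (x∈p⇒∣p-x∣<∣p∣ x∈p)

  ∣p∣≤1+∣p-x∣ : ∀ (p : Subset n) x → ∣ p ∣ ≤ suc ∣ p - x ∣
  ∣p∣≤1+∣p-x∣ (inside  ∷ p) zero    = s≤s (≤-reflexive (cong ∣_∣ (sym (p─⊥≡p p))))
  ∣p∣≤1+∣p-x∣ (outside ∷ p) zero    = m≤n⇒m≤1+n (≤-reflexive (cong ∣_∣ (sym (p─⊥≡p p))))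
  ∣p∣≤1+∣p-x∣ (inside  ∷ p) (suc x) = s≤s (∣p∣≤1+∣p-x∣ p x)
  ∣p∣≤1+∣p-x∣ (outside ∷ p) (suc x) = ∣p∣≤1+∣p-x∣ p x

  0<∣p∣⇒Nonempty : ∀ (p : Subset n) → 0 < ∣ p ∣ → Nonempty p
  0<∣p∣⇒Nonempty (inside  ∷ p) _ = zero , here
  0<∣p∣⇒Nonempty (outside ∷ p) h with 0<∣p∣⇒Nonempty p h
  ... | x , x∈p = suc x , there x∈p

  ∣p∣≡1⇒singleton : ∣ p ∣ ≡ 1 → ∃[ c ] c ∈ p × (∀ {x} → x ∈ p → x ≡ c)
  ∣p∣≡1⇒singleton {p = p} ∣p∣≡1 with 0<∣p∣⇒Nonempty p (subst (0 <_) (sym ∣p∣≡1) (s≤s z≤n))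
  ... | c , c∈p = c , c∈p , unique
    where
    unique : x ∈ p → x ≡ c
    unique {x} x∈p with x ≟ c
    ... | yes x≡c = x≡c
    ... | no  x≢c = contradiction
      (≤-trans (s≤s (x∈p⇒0<∣p∣ (x∈p∧x≢y⇒x∈p-y x∈p x≢c))) (≤-trans (x∈p⇒∣p-x∣<∣p∣ c∈p) (≤-reflexive ∣p∣≡1))) λ { (s≤s ()) }

  select : ∀ k (p : Subset n) → k ≤ ∣ p ∣ → ∃[ xs ] length xs ≡ k × Unique xs × All (_∈ p) xs
  select zero    p _  = [] , refl , [] , []
  select (suc k) p k< with 0<∣p∣⇒Nonempty p (≤-trans (s≤s z≤n) k<)
  ... | x , x∈p with select k (p - x) (ℕ.s≤s⁻¹ (≤-trans k< (∣p∣≤1+∣p-x∣ p x)))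
  ... | xs , len , uniq , xs∈ = x ∷ xs , cong suc len
    , All.map (λ y∈ x≡y → x∈p-y⇒x≢y {p = p} y∈ (sym x≡y)) xs∈ ∷ uniq
    , x∈p ∷ All.map x∈p-y⇒x∈p xs∈

  ∣p∪q∣≤∣p∣+∣q∣ : ∀ (p q : Subset n) → ∣ p ∪ q ∣ ≤ ∣ p ∣ + ∣ q ∣
  ∣p∪q∣≤∣p∣+∣q∣ []            []            = z≤n
  ∣p∪q∣≤∣p∣+∣q∣ (inside  ∷ p) (inside  ∷ q) = s≤s (≤-trans (∣p∪q∣≤∣p∣+∣q∣ p q) (+-monoʳ-≤ ∣ p ∣ (n≤1+n ∣ q ∣)))
  ∣p∪q∣≤∣p∣+∣q∣ (inside  ∷ p) (outside ∷ q) = s≤s (∣p∪q∣≤∣p∣+∣q∣ p q)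
  ∣p∪q∣≤∣p∣+∣q∣ (outside ∷ p) (inside  ∷ q) = ≤-trans (s≤s (∣p∪q∣≤∣p∣+∣q∣ p q)) (≤-reflexive (sym (+-suc ∣ p ∣ ∣ q ∣)))
  ∣p∪q∣≤∣p∣+∣q∣ (outside ∷ p) (outside ∷ q) = ∣p∪q∣≤∣p∣+∣q∣ p q

  ∣p∣≡∣p∩q∣+∣p─q∣ : ∀ (p q : Subset n) → ∣ p ∣ ≡ ∣ p ∩ q ∣ + ∣ p ─ q ∣
  ∣p∣≡∣p∩q∣+∣p─q∣ []            []            = refl
  ∣p∣≡∣p∩q∣+∣p─q∣ (inside  ∷ p) (inside  ∷ q) = cong suc (∣p∣≡∣p∩q∣+∣p─q∣ p q)
  ∣p∣≡∣p∩q∣+∣p─q∣ (inside  ∷ p) (outside ∷ q) = trans (cong suc (∣p∣≡∣p∩q∣+∣p─q∣ p q)) (sym (+-suc _ _))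
  ∣p∣≡∣p∩q∣+∣p─q∣ (outside ∷ p) (inside  ∷ q) = ∣p∣≡∣p∩q∣+∣p─q∣ p q
  ∣p∣≡∣p∩q∣+∣p─q∣ (outside ∷ p) (outside ∷ q) = ∣p∣≡∣p∩q∣+∣p─q∣ p q

  disjoint⇒∣p∪q∣≡∣p∣+∣q∣ : ∀ (p q : Subset n) → (∀ {x} → x ∈ p → x ∉ q) → ∣ p ∪ q ∣ ≡ ∣ p ∣ + ∣ q ∣
  disjoint⇒∣p∪q∣≡∣p∣+∣q∣ []            []            _   = refl
  disjoint⇒∣p∪q∣≡∣p∣+∣q∣ (inside  ∷ p) (inside  ∷ q) dis = contradiction here (dis here)
  disjoint⇒∣p∪q∣≡∣p∣+∣q∣ (inside  ∷ p) (outside ∷ q) dis =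
    cong suc (disjoint⇒∣p∪q∣≡∣p∣+∣q∣ p q (λ x∈p x∈q → dis (there x∈p) (there x∈q)))
  disjoint⇒∣p∪q∣≡∣p∣+∣q∣ (outside ∷ p) (inside  ∷ q) dis =
    trans (cong suc (disjoint⇒∣p∪q∣≡∣p∣+∣q∣ p q (λ x∈p x∈q → dis (there x∈p) (there x∈q)))) (sym (+-suc _ _))
  disjoint⇒∣p∪q∣≡∣p∣+∣q∣ (outside ∷ p) (outside ∷ q) dis =
    disjoint⇒∣p∪q∣≡∣p∣+∣q∣ p q (λ x∈p x∈q → dis (there x∈p) (there x∈q))

  ∈-fromList : ∀ {xs} → x List.∈ xs → x ∈ fromList xs
  ∈-fromList {x = x} (here refl) = x∈p∪q⁺ (inj₁ (x∈⁅x⁆ x))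
  ∈-fromList         (there x∈)  = x∈p∪q⁺ (inj₂ (∈-fromList x∈))

  ∣fromList∣≤length : ∀ (xs : List (Fin n)) → ∣ fromList xs ∣ ≤ length xs
  ∣fromList∣≤length {n} []       = ≤-reflexive (∣⊥∣≡0 n)
  ∣fromList∣≤length     (x ∷ xs) = ≤-trans (∣p∪q∣≤∣p∣+∣q∣ ⁅ x ⁆ (fromList xs))
    (+-mono-≤ (≤-reflexive (∣⁅x⁆∣≡1 x)) (∣fromList∣≤length xs))

  χ : Subset n → Fin n → ℕ
  χ p x = if lookup p x then 1 else 0

  χ-mono : ∀ (p : Subset n) x (q : Subset m) y → (x ∈ p → y ∈ q) → χ p x ≤ χ q y
  χ-mono p x q y imp with lookup p x in eq
  ... | false = z≤n
  ... | true rewrite Vec.[]=⇒lookup (imp (Vec.lookup⇒[]= x p eq)) = ≤-refl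

  ∣p∣≡∑χ : ∀ (p : Subset n) → ∣ p ∣ ≡ sum (χ p)
  ∣p∣≡∑χ []            = refl
  ∣p∣≡∑χ (inside  ∷ p) = cong suc (∣p∣≡∑χ p)
  ∣p∣≡∑χ (outside ∷ p) = ∣p∣≡∑χ p

  ∑-mono-≤ : ∀ {f g : Fin n → ℕ} → (∀ i → f i ≤ g i) → sum f ≤ sum g
  ∑-mono-≤ {zero}  f≤g = z≤n
  ∑-mono-≤ {suc n} f≤g = +-mono-≤ (f≤g zero) (∑-mono-≤ (f≤g ∘ suc))

  term≤∑ : ∀ (f : Fin n → ℕ) i → f i ≤ sum f
  term≤∑ f zero    = m≤m+n _ _
  term≤∑ f (suc i) = ≤-trans (term≤∑ (f ∘ suc) i) (m≤n+m _ _)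

  *∣p∣≤∑ : ∀ {f : Fin n → ℕ} p → (∀ {x} → x ∈ p → m ≤ f x) → m * ∣ p ∣ ≤ sum f
  *∣p∣≤∑ {m = m} []            _ = ≤-reflexive (*-zeroʳ m)
  *∣p∣≤∑ {m = m} (inside  ∷ p) h =
    ≤-trans (≤-reflexive (*-suc m ∣ p ∣)) (+-mono-≤ (h here) (*∣p∣≤∑ p (h ∘ there)))
  *∣p∣≤∑         (outside ∷ p) h = ≤-trans (*∣p∣≤∑ p (h ∘ there)) (m≤n+m _ _)

  ∑≤*∣p∣ : ∀ {f : Fin n → ℕ} p → (∀ {x} → x ∈ p → f x ≤ k) → (∀ {x} → x ∉ p → f x ≡ 0) → sum f ≤ k * ∣ p ∣
  ∑≤*∣p∣         []            _ _ = z≤n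
  ∑≤*∣p∣ {k = k} (inside  ∷ p) h z = ≤-trans (+-mono-≤ (h here) (∑≤*∣p∣ p (h ∘ there) (λ x∉ → z λ { (there x∈) → x∉ x∈ })))
                                             (≤-reflexive (sym (*-suc k ∣ p ∣)))
  ∑≤*∣p∣         (outside ∷ p) h z rewrite z {zero} (λ ()) =
    ∑≤*∣p∣ p (h ∘ there) (λ x∉ → z λ { (there x∈) → x∉ x∈ })

  ∑∣∣-swap : (R C : Fin n → Subset n) → (∀ {u v} → u ∈ R v → v ∈ C u) → sum (∣_∣ ∘ R) ≤ sum (∣_∣ ∘ C)
  ∑∣∣-swap R C RC = begin
    sum (∣_∣ ∘ R)                   ≤⟨ ∑-mono-≤ (λ v → ≤-reflexive (∣p∣≡∑χ (R v))) ⟩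
    sum (λ v → sum (χ (R v)))       ≤⟨ ∑-mono-≤ (λ v → ∑-mono-≤ (λ u → χ-mono (R v) u (C u) v RC)) ⟩
    sum (λ v → sum (λ u → χ (C u) v)) ≡⟨ ∑-comm (λ v u → χ (C u) v) ⟩
    sum (λ u → sum (χ (C u)))       ≤⟨ ∑-mono-≤ (λ u → ≤-reflexive (sym (∣p∣≡∑χ (C u)))) ⟩
    sum (∣_∣ ∘ C)                   ∎
    where open ≤-Reasoning

  -- Pairs of some `v ∈ p` and some `u ∈ q` with `u ∈ f v` are counted once by `v` and once by `u`.
  double-counting : (f g : Fin n → Subset n) → (∀ {u v} → u ∈ f v → v ∈ g u) → ∀ p q →
                    (∀ {v} → v ∈ p → m ≤ ∣ f v ∩ q ∣) → (∀ {u} → u ∈ q → ∣ g u ∩ p ∣ ≤ k) →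
                    m * ∣ p ∣ ≤ k * ∣ q ∣
  double-counting {n} {m} {k} f g fg p q m≤ ≤k = begin
    m * ∣ p ∣     ≤⟨ *∣p∣≤∑ p (λ v∈p → ≤-trans (m≤ v∈p) (≤-reflexive (cong ∣_∣ (sym (restrict-∈ f v∈p))))) ⟩
    sum (∣_∣ ∘ R) ≤⟨ ∑∣∣-swap R C RC ⟩
    sum (∣_∣ ∘ C) ≤⟨ ∑≤*∣p∣ q (λ u∈q → ≤-trans (≤-reflexive (cong ∣_∣ (restrict-∈ g u∈q))) (≤k u∈q))
                              (λ u∉q → trans (cong ∣_∣ (restrict-∉ g u∉q)) (∣⊥∣≡0 n)) ⟩
    k * ∣ q ∣     ∎
    where
    open ≤-Reasoning
    -- Emptying the sets outside `p` turns a sum over `p` into one over all nodes, where summation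
    -- can be exchanged.
    restrict : (Fin n → Subset n) → (p q : Subset n) → Fin n → Subset n
    restrict f p q v with v ∈? p
    ... | yes _ = f v ∩ q
    ... | no  _ = ⊥

    restrict-∈ : ∀ f {p q v} → v ∈ p → restrict f p q v ≡ f v ∩ q
    restrict-∈ f {p} {v = v} v∈p with v ∈? p
    ... | yes _ = refl
    ... | no v∉p = contradiction v∈p v∉p

    restrict-∉ : ∀ f {p q v} → v ∉ p → restrict f p q v ≡ ⊥
    restrict-∉ f {p} {v = v} v∉p with v ∈? p
    ... | yes v∈p = contradiction v∈p v∉p
    ... | no _ = refl

    R = restrict f p q
    C = restrict g q p

    RC : ∀ {u v} → u ∈ R v → v ∈ C u
    RC {u} {v} u∈ with v ∈? p
    ... | no _ = contradiction u∈ ∉⊥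
    ... | yes v∈p with x∈p∩q⁻ (f v) q u∈
    ...   | u∈f , u∈q = subst (v ∈_) (sym (restrict-∈ g u∈q)) (x∈p∩q⁺ (fg u∈f , v∈p))

open Counting

-- Walks, T-paths and separation by a single node.

module Connectivity {n} (G : Graph n) where
  open Graph G

  private variable
    u v w x y c r : Fin n
    L : List (Fin n)

  EdgeIn-mono : ∀ {U V} → U ⊆ V → EdgeIn G U x y → EdgeIn G V x y
  EdgeIn-mono U⊆V (x∈ , y∈ , x~y) = U⊆V x∈ , U⊆V y∈ , x~y

  EdgeIn-sym : ∀ {U} → EdgeIn G U x y → EdgeIn G U y x
  EdgeIn-sym (x∈ , y∈ , x~y) = y∈ , x∈ , symm x~y

  _⟨_⟩⟶*_ : Fin n → Subset n → Fin n → Set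
  x ⟨ U ⟩⟶* y = Star (EdgeIn G U) x y

  ⟶*-mono : ∀ {U V} → U ⊆ V → x ⟨ U ⟩⟶* y → x ⟨ V ⟩⟶* y
  ⟶*-mono U⊆V = gmap id (EdgeIn-mono U⊆V)

  ⟶*-sym : ∀ {U} → x ⟨ U ⟩⟶* y → y ⟨ U ⟩⟶* x
  ⟶*-sym = reverse EdgeIn-sym

  -- The walk is cut at its last visit to `u`, if there is one; what follows avoids `u`.
  last-exit : ∀ {U} → u ≢ v → x ⟨ U ⟩⟶* v →
              x ⟨ U - u ⟩⟶* v ⊎ (∃[ w ] u ~ w × u ∈ U × w ∈ U - u × w ⟨ U - u ⟩⟶* v)
  last-exit u≢v ε = inj₁ ε
  last-exit {u} {v} {x} {U} u≢v (_◅_ {j = y} (x∈ , y∈ , x~y) s) with last-exit u≢v s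
  ... | inj₂ exit = inj₂ exit
  ... | inj₁ s′ with y ≟ u | x ≟ u
  ...   | no y≢u | yes refl = inj₂ (y , x~y , x∈ , x∈p∧x≢y⇒x∈p-y y∈ y≢u , s′)
  ...   | no y≢u | no x≢u   = inj₁ ((x∈p∧x≢y⇒x∈p-y x∈ x≢u , x∈p∧x≢y⇒x∈p-y y∈ y≢u , x~y) ◅ s′)
  ...   | yes refl | _ with s′
  ...     | ε            = contradiction refl u≢v
  ...     | (u∈ , _) ◅ _ = contradiction refl (x∈p-y⇒x≢y {p = U} u∈)

  -- A walk need not return to its first node, so that node can be deleted before the search
  -- continues from a neighbour; the recursion is on the shrinking node set.
  ⟶*? : ∀ U x y → Dec (x ⟨ U ⟩⟶* y)
  ⟶*? U = go U (⊂-wellFounded U)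
    where
    go : ∀ U → Acc _⊂_ U → ∀ x y → Dec (x ⟨ U ⟩⟶* y)
    go U (acc rs) x y with x ≟ y
    ... | yes refl = yes ε
    ... | no  x≢y with x ∈? U
    ...   | no x∉U = no λ { ε → x≢y refl ; ((x∈U , _) ◅ _) → x∉U x∈U }
    ...   | yes x∈U with any? (λ w → (x ~? w) ×-dec (w ∈? (U - x)) ×-dec go (U - x) (rs (x∈p⇒p-x⊂p x∈U)) w y)
    ...     | yes (w , x~w , w∈ , s) = yes ((x∈U , x∈p-y⇒x∈p w∈ , x~w) ◅ ⟶*-mono x∈p-y⇒x∈p s)
    ...     | no ¬exit = no λ s → [ (λ { ε → x≢y refl ; ((x∈ , _) ◅ _) → x∈p-y⇒x≢y {p = U} x∈ refl })
                                  , (λ (w , x~w , _ , w∈ , s′) → ¬exit (w , x~w , w∈ , s′)) ]′ (last-exit x≢y s)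

  Linked⇒⟶* : ∀ {U} x L y → Linked _~_ (x ∷ (L ∷ʳ y)) → All (_∈ U) (x ∷ (L ∷ʳ y)) → x ⟨ U ⟩⟶* y
  Linked⇒⟶* x []      y (x~y ∷ _)   (x∈ ∷ y∈ ∷ []) = (x∈ , y∈ , x~y) ◅ ε
  Linked⇒⟶* x (w ∷ L) y (x~w ∷ lnk) (x∈ ∷ w∈ ∷ ∈s) = (x∈ , w∈ , x~w) ◅ Linked⇒⟶* w L y lnk (w∈ ∷ ∈s)

  -- The part of a T-path of G[U] behind its first node.
  data Route (T U : Subset n) : Fin n → List (Fin n) → Fin n → Set where
    stop : y ∈ T → y ∈ U → Route T U y [] y
    via  : w ∉ T → w ∈ U → w ~ x → All (w ≢_) L → Route T U x L y → Route T U w (w ∷ L) y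

  module _ {T U : Subset n} where

    Route-end∈T : Route T U w L y → y ∈ T
    Route-end∈T (stop y∈T _)    = y∈T
    Route-end∈T (via _ _ _ _ ρ) = Route-end∈T ρ

    Route-inner∉T : Route T U w L y → All (_∉ T) L
    Route-inner∉T (stop _ _)        = []
    Route-inner∉T (via w∉T _ _ _ ρ) = w∉T ∷ Route-inner∉T ρ

    Route-⊆U : Route T U w L y → All (_∈ U) (L ∷ʳ y)
    Route-⊆U (stop _ y∈U)      = y∈U ∷ []
    Route-⊆U (via _ w∈U _ _ ρ) = w∈U ∷ Route-⊆U ρ

    Route-unique : Route T U w L y → Unique (L ∷ʳ y)
    Route-unique (stop _ _)           = [] ∷ []
    Route-unique (via w∉T _ _ w∉L ρ) =
      All.∷ʳ⁺ w∉L (λ { refl → w∉T (Route-end∈T ρ) }) ∷ Route-unique ρ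

    Route-linked : x ~ w → Route T U w L y → Linked _~_ (x ∷ (L ∷ʳ y))
    Route-linked x~w (stop _ _)        = x~w ∷ [-]
    Route-linked x~w (via _ _ w~ _ ρ) = x~w ∷ Route-linked w~ ρ

    Route-suffix : w List.∈ L → Route T U x L y → ∃[ L′ ] Route T U w L′ y
    Route-suffix (here refl) ρ@(via _ _ _ _ _) = _ , ρ
    Route-suffix (there w∈)  (via _ _ _ _ ρ)   = Route-suffix w∈ ρ

    -- If `w` already lies on the route, the loop is skipped by starting at its occurrence, which
    -- keeps the nodes distinct.
    Route-cons : w ∉ T → w ∈ U → w ~ x → Route T U x L y → ∃[ L′ ] Route T U w L′ y
    Route-cons {w} {L = L} w∉T w∈U w~x ρ with Any.any? (w ≟_) L
    ... | yes w∈L = Route-suffix w∈L ρ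
    ... | no  w∉L = _ , via w∉T w∈U w~x (All.¬Any⇒All¬ L w∉L) ρ

    Route⇒TPath : x ∈ T → x ∈ U → x ≢ y → x ~ w → Route T U w L y → TPath G T U
    Route⇒TPath {x} {y} {L = L} x∈T x∈U x≢y x~w ρ = record
      { start    = x
      ; end      = y
      ; inner    = L
      ; distinct = All.∷ʳ⁺ (All.map (λ z∉T → λ { refl → z∉T x∈T }) (Route-inner∉T ρ)) x≢y ∷ Route-unique ρ
      ; adjacent = Route-linked x~w ρ
      ; nodes∈U  = x∈U ∷ Route-⊆U ρ
      ; start∈T  = x∈T
      ; end∈T    = Route-end∈T ρ
      ; inner∉T  = Route-inner∉T ρ
      }

  -- Read backwards from `y`, each node of a walk avoiding `c` has a route to some node of `T ─ X⁺`.
  -- A node of `X` in front of such a route would complete a covering T-path, so the walk never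
  -- enters `X`.
  uncovered⇒separated : ∀ {T U X} → T ⊆ U → X ⊆ T → (∀ {t} → t ∈ T → t ∉ X → t ≢ c → t ∈ T ─ (_⁺ G X)) →
    ¬ (Σ[ Q ∈ TPath G T U ] Covers G Q X) → x ∈ X → y ∈ T ─ (_⁺ G X) → ¬ (x ⟨ U - c ⟩⟶* y)
  uncovered⇒separated {c} {T = T} {U} {X} T⊆U X⊆T beyond uncovered x∈X y∈ s = proj₁ (reach s y∈) x∈X
    where
    ∉X : y ∈ T ─ (_⁺ G X) → y ∉ X
    ∉X y∈ y∈X = x∈p─q⇒x∉q {p = T} y∈ (x∈p∪q⁺ (inj₁ y∈X))

    ∈T : y ∈ T ─ (_⁺ G X) → y ∈ T
    ∈T = p─q⊆p T (_⁺ G X)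

    reach : x ⟨ U - c ⟩⟶* y → y ∈ T ─ (_⁺ G X) →
            x ∉ X × (∃[ L ] ∃[ z ] Route T U x L z × z ∈ T ─ (_⁺ G X))
    reach ε y∈ = ∉X y∈ , [] , _ , stop (∈T y∈) (T⊆U (∈T y∈)) , y∈
    reach {x} ((x∈ , x′∈ , x~x′) ◅ s) y∈ with reach s y∈
    ... | _ , L , z , ρ , z∈ = x∉X , extend
      where
      x∉X : x ∉ X
      x∉X x∈X = uncovered
        ( Route⇒TPath (X⊆T x∈X) (x∈p-y⇒x∈p x∈) (λ { refl → ∉X z∈ x∈X }) x~x′ ρ
        , inj₁ (x∈X , z∈))

      extend : ∃[ L ] ∃[ z ] Route T U x L z × z ∈ T ─ (_⁺ G X)
      extend with x ∈? T
      -- A node of `T` on the walk is neither in `X` nor equal to `c`, so it lies in `T ─ X⁺` itself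
      -- and a new route starts there.
      ... | yes x∈T = [] , x , stop x∈T (x∈p-y⇒x∈p x∈) , beyond x∈T x∉X (x∈p-y⇒x≢y {p = U} x∈)
      ... | no  x∉T with Route-cons x∉T (x∈p-y⇒x∈p x∈) x~x′ ρ
      ...   | L′ , ρ′ = L′ , z , ρ′ , z∈

  -- In `parent`, the node `u` only expresses that `r` is not the first node of `T`.
  record Ranking (T : Subset n) : Set where
    field
      rank      : Fin n → ℕ
      injective : rank x ≡ rank y → x ≡ y
      parent    : u ∈ T → r ∈ T → rank u < rank r → ∃[ c ] c ∈ T × rank c < rank r × c ~ r

  -- The number of cut-off nodes as a potential.

  module Potential {T : Subset n} (ranking : Ranking T) where
    open Ranking ranking

    Joined : Subset n → Fin n → Fin n → Fin n → Set
    Joined S c u r = u ∈ T × u ≢ c × rank u < rank r × u ⟨ (T ∪ S) - c ⟩⟶* r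

    -- For a node `r` of `T` other than `c`: it comes first among the nodes of `T` in its component
    -- of `G[T ∪ S] − c`.
    Earliest : Subset n → Fin n → Fin n → Set
    Earliest S c r = ¬ (∃[ u ] Joined S c u r)

    -- The nodes cut off correspond to the pairs of a node c of T and a component of G[T ∪ S] − c that meets T,
    -- apart from the component with the earliest node.
    CutOff : Subset n → Fin n → Set
    CutOff S r = r ∈ T × ∃[ c ] (c ∈ T × rank c < rank r × c ~ r) × Earliest S c r

    cutOff? : ∀ S r → Dec (CutOff S r)
    cutOff? S r = r ∈? T ×-dec any? λ c →
      (c ∈? T ×-dec rank c <? rank r ×-dec c ~? r) ×-dec
      ¬? (any? λ u → u ∈? T ×-dec ¬? (u ≟ c) ×-dec rank u <? rank r ×-dec ⟶*? ((T ∪ S) - c) u r)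

    CutOffs : Subset n → Subset n
    CutOffs S = ⟪ cutOff? S ⟫

    ∪-mono : ∀ {S S′} → S ⊆ S′ → T ∪ S ⊆ T ∪ S′
    ∪-mono {S} {S′} S⊆S′ x∈ = x∈p∪q⁺ ([ inj₁ , (λ x∈S → inj₂ (S⊆S′ x∈S)) ]′ (x∈p∪q⁻ T S x∈))

    CutOff-antitone : ∀ {S S′} → S ⊆ S′ → CutOff S′ r → CutOff S r
    CutOff-antitone S⊆S′ (r∈T , c , c-parent , earliest) =
      r∈T , c , c-parent , λ (u , u∈T , u≢c , u<r , s) →
        earliest (u , u∈T , u≢c , u<r , ⟶*-mono (-‿mono (∪-mono S⊆S′)) s)

    ∈T-c : ∀ {S} → x ∈ T → x ≢ c → x ∈ (T ∪ S) - c
    ∈T-c x∈T = x∈p∧x≢y⇒x∈p-y (x∈p∪q⁺ (inj₁ x∈T))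

    least : ∀ S → x ∈ T → x ≢ c →
            ∃[ r ] r ∈ T × r ≢ c × r ⟨ (T ∪ S) - c ⟩⟶* x × Earliest S c r
    least {x} {c} S x∈T x≢c = go x (<-wellFounded (rank x)) x∈T x≢c
      where
      go : ∀ x → Acc _<_ (rank x) → x ∈ T → x ≢ c →
           ∃[ r ] r ∈ T × r ≢ c × r ⟨ (T ∪ S) - c ⟩⟶* x × Earliest S c r
      go x (acc rs) x∈T x≢c
        with any? (λ u → u ∈? T ×-dec ¬? (u ≟ c) ×-dec rank u <? rank x ×-dec ⟶*? ((T ∪ S) - c) u x)
      ... | no earliest = x , x∈T , x≢c , ε , earliest
      ... | yes (u , u∈T , u≢c , u<x , s) with go u (rs u<x) u∈T u≢c
      ...   | r , r∈T , r≢c , s′ , earliest = r , r∈T , r≢c , s′ ◅◅ s , earliest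

    -- An earlier neighbour other than `c` would survive the removal of `c` and precede `r` in its
    -- component. Hence `r` determines `c`, and cut-off nodes can be counted without their cut
    -- nodes.
    parent-unique : ∀ {S p} → r ∈ T → r ≢ c → Earliest S c r →
                    p ∈ T → rank p < rank r → p ~ r → p ≡ c
    parent-unique {r} {c} {p = p} r∈T r≢c earliest p∈T p<r p~r with p ≟ c
    ... | yes p≡c = p≡c
    ... | no  p≢c = contradiction
      (p , p∈T , p≢c , p<r , (∈T-c p∈T p≢c , ∈T-c r∈T r≢c , p~r) ◅ ε) earliest

    -- Some earlier neighbour of `r` exists and must be `c`, so `r` is cut off at first. Later on
    -- `c` is still the only candidate, but the earlier node `u` is now in the component of `r`.
    join-least : ∀ {S S′} → u ∈ T → u ≢ c → r ∈ T → r ≢ c → Earliest S c r →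
                 rank u < rank r → u ⟨ (T ∪ S′) - c ⟩⟶* r → CutOff S r × ¬ CutOff S′ r
    join-least {S′ = S′} u∈T u≢c r∈T r≢c earliest u<r s with parent u∈T r∈T u<r
    ... | p , p∈T , p<r , p~r with parent-unique r∈T r≢c earliest p∈T p<r p~r
    ... | refl = (r∈T , p , (p∈T , p<r , p~r) , earliest) , after
      where
      after : ¬ CutOff S′ _
      after (_ , q , (q∈T , q<r , q~r) , earliest′)
        with parent-unique r∈T r≢c earliest q∈T q<r q~r
      ... | refl = earliest′ (_ , u∈T , u≢c , u<r , s)

    -- When two components merge, the later of their first nodes stops being first and is no longer
    -- cut off; no node becomes cut off, as larger sets only allow more walks.
    join-components : ∀ {S S′} → S ⊆ S′ → x ∈ T → x ≢ c → y ∈ T → y ≢ c →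
      ¬ (x ⟨ (T ∪ S) - c ⟩⟶* y) → x ⟨ (T ∪ S′) - c ⟩⟶* y → ∣ CutOffs S′ ∣ < ∣ CutOffs S ∣
    join-components {x} {c} {y} {S} {S′} S⊆S′ x∈T x≢c y∈T y≢c x↛y x⟶y
      with least S x∈T x≢c | least S y∈T y≢c
    ... | r , r∈T , r≢c , r⟶x , r-least | r′ , r′∈T , r′≢c , r′⟶y , r′-least =
      p⊂q⇒∣p∣<∣q∣
        ( (λ v∈ → ∈⟪⟫⁺ (cutOff? S) (CutOff-antitone S⊆S′ (∈⟪⟫⁻ (cutOff? S′) v∈)))
        , drop (<-cmp (rank r) (rank r′)))
      where
      lift : u ⟨ (T ∪ S) - c ⟩⟶* v → u ⟨ (T ∪ S′) - c ⟩⟶* v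
      lift = ⟶*-mono (-‿mono (∪-mono S⊆S′))

      r⟶r′ : r ⟨ (T ∪ S′) - c ⟩⟶* r′
      r⟶r′ = lift r⟶x ◅◅ x⟶y ◅◅ ⟶*-sym (lift r′⟶y)

      lost : CutOff S v × ¬ CutOff S′ v → ∃[ v ] v ∈ CutOffs S × v ∉ CutOffs S′
      lost (before , after) = _ , ∈⟪⟫⁺ (cutOff? S) before , after ∘ ∈⟪⟫⁻ (cutOff? S′)

      drop : _ → ∃[ v ] v ∈ CutOffs S × v ∉ CutOffs S′
      drop (tri< r<r′ _ _) = lost (join-least r∈T r≢c r′∈T r′≢c r′-least r<r′ r⟶r′)
      drop (tri> _ _ r′<r) = lost (join-least r′∈T r′≢c r∈T r≢c r-least r′<r (⟶*-sym r⟶r′))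
      -- A common first node would have connected `x` and `y` already.
      drop (tri≈ _ eq _) with injective eq
      ... | refl = contradiction (⟶*-sym r⟶x ◅◅ r′⟶y) x↛y

-- The effect of one iteration.

module Steps {n} (G : Graph n) where
  open Graph G
  open Connectivity G

  private variable
    u v w x y c r : Fin n
    L : List (Fin n)

  Γ⇒∉ : ∀ {X} → v ∈ Γ G X → v ∉ X
  Γ⇒∉ {X = X} v∈ = proj₁ (∈⟪⟫⁻ (λ v → ¬? (v ∈? X) ×-dec any? (λ u → u ∈? X ×-dec u ~? v)) v∈)

  module _ {T : Subset n} (ranking : Ranking T) where
    open Potential ranking

    step-size : ∀ {S S′} → Step G T S S′ → ∣ S′ ∣ ≤ ∣ S ∣ + 2
    step-size {S} (step _ _ _ _ _ P _ short) =
      ≤-trans (∣p∪q∣≤∣p∣+∣q∣ S (fromList (TPath.inner P)))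
              (+-monoʳ-≤ ∣ S ∣ (≤-trans (∣fromList∣≤length (TPath.inner P)) short))

    -- The single node `c` of `Γ[ T ] X` separates `X` from `T ─ X⁺` in `G[T ∪ S]`, as no T-path
    -- covers `X`. The added path joins the two sides and avoids `c`, because `c` is in `T` and the
    -- inner nodes are not.
    step-progress : ∀ {S S′} → Step G T S S′ → ∣ CutOffs S′ ∣ < ∣ CutOffs S ∣
    step-progress {S} (step _ X (X⊆T , _ , _) one uncovered P covers _) with ∣p∣≡1⇒singleton one
    ... | c , c∈Γ , c-unique = join covers
      where
      open TPath P
      S′ = S ∪ fromList inner

      c∈T : c ∈ T
      c∈T = p∩q⊆q (Γ G X) T c∈Γ

      c∉X : c ∉ X
      c∉X = Γ⇒∉ (p∩q⊆p (Γ G X) T c∈Γ)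

      separated : x ∈ X → y ∈ T ─ (_⁺ G X) → ¬ (x ⟨ (T ∪ S) - c ⟩⟶* y)
      -- Within `T`, the set `X⁺` consists of `X` and `c` only.
      separated = uncovered⇒separated (p⊆p∪q S) X⊆T
        (λ t∈T t∉X t≢c → x∈p∧x∉q⇒x∈p─q t∈T λ t∈X⁺ →
          [ t∉X , (λ t∈Γ → t≢c (c-unique (x∈p∩q⁺ (t∈Γ , t∈T)))) ]′ (x∈p∪q⁻ X (Γ G X) t∈X⁺))
        uncovered

      ≢c : ∀ {y} → y ∈ T ─ (_⁺ G X) → y ≢ c
      ≢c y∈ refl = x∈p─q⇒x∉q {p = T} y∈ (x∈p∪q⁺ (inj₂ (p∩q⊆p (Γ G X) T c∈Γ)))

      path : start ≢ c → end ≢ c → start ⟨ (T ∪ S′) - c ⟩⟶* end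
      path s≢c e≢c = Linked⇒⟶* start inner end adjacent
        (∈T-c {S = S′} start∈T s≢c ∷ All.∷ʳ⁺ (All.tabulate λ z∈ → x∈p∧x≢y⇒x∈p-y
          (x∈p∪q⁺ (inj₂ (x∈p∪q⁺ {p = S} (inj₂ (∈-fromList z∈)))))
          (λ { refl → All.lookup inner∉T z∈ c∈T })) (∈T-c {S = S′} end∈T e≢c))

      joined : x ∈ X → y ∈ T ─ (_⁺ G X) → x ⟨ (T ∪ S′) - c ⟩⟶* y → ∣ CutOffs S′ ∣ < ∣ CutOffs S ∣
      joined x∈X y∈ = join-components (p⊆p∪q (fromList inner)) (X⊆T x∈X) (λ { refl → c∉X x∈X })
        (p─q⊆p T (_⁺ G X) y∈) (≢c y∈) (separated x∈X y∈)

      join : Covers G P X → ∣ CutOffs S′ ∣ < ∣ CutOffs S ∣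
      join (inj₁ (s∈X , e∈)) = joined s∈X e∈ (path (λ { refl → c∉X s∈X }) (≢c e∈))
      join (inj₂ (e∈X , s∈)) = joined e∈X s∈ (⟶*-sym (path (≢c s∈) (λ { refl → c∉X e∈X })))

    -- Each iteration adds at most two nodes and pays for them with at least one cut-off node.
    execution-size : ∀ {S S′} → Star (Step G T) S S′ → ∣ S′ ∣ + 2 * ∣ CutOffs S′ ∣ ≤ ∣ S ∣ + 2 * ∣ CutOffs S ∣
    execution-size ε = ≤-refl
    execution-size {S} {S′} (_◅_ {j = S₁} st run) = begin
      ∣ S′ ∣ + 2 * ∣ CutOffs S′ ∣       ≤⟨ execution-size run ⟩
      ∣ S₁ ∣ + 2 * ∣ CutOffs S₁ ∣       ≤⟨ +-monoˡ-≤ _ (step-size st) ⟩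
      ∣ S ∣ + 2 + 2 * ∣ CutOffs S₁ ∣    ≡⟨ +-assoc ∣ S ∣ 2 _ ⟩
      ∣ S ∣ + (2 + 2 * ∣ CutOffs S₁ ∣)  ≡⟨ cong (∣ S ∣ +_) (sym (*-suc 2 ∣ CutOffs S₁ ∣)) ⟩
      ∣ S ∣ + 2 * suc ∣ CutOffs S₁ ∣    ≤⟨ +-monoʳ-≤ ∣ S ∣ (*-monoʳ-≤ 2 (step-progress st)) ⟩
      ∣ S ∣ + 2 * ∣ CutOffs S ∣         ∎
      where open ≤-Reasoning

  -- Breadth-first ranking and the initial potential.

  least-witness : ∀ {P : ℕ → Set} → (∀ k → Dec (P k)) → ∀ k → P k →
                  ∃[ j ] P j × (∀ {i} → i < j → ¬ P i)
  least-witness P? k pk with P? 0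
  ... | yes p0 = 0 , p0 , λ ()
  least-witness P? zero pk    | no ¬p0 = contradiction pk ¬p0
  least-witness P? (suc k) pk | no ¬p0 with least-witness (P? ∘ suc) k pk
  ... | j , pj , ¬below = suc j , pj , λ { {zero} _ → ¬p0 ; {suc i} (s≤s i<j) → ¬below i<j }

  -- Breadth-first order on the connected set A, then B, then the rest of T.
  module TieredRanking (A B T : Subset n) (a₀ : Fin n) (a₀∈A : a₀ ∈ A) (A-connected : Connected G A)
    (A⊆T : A ⊆ T)
    (B-parent : ∀ {v} → v ∉ A → v ∈ B → ∃[ a ] a ∈ A × a ~ v)
    (rest-parents : ∀ {v} → v ∈ T → v ∉ A → v ∉ B →
                    ∃[ a ] ∃[ b ] a ∈ A × b ∈ B × b ∈ T × a ≢ b × a ~ v × b ~ v)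
    where

    -- Walks of exactly `k` edges from `a₀` inside `A`; the least such `k` is the breadth-first
    -- depth.
    Reach : ℕ → Fin n → Set
    Reach zero    v = v ≡ a₀
    Reach (suc k) v = v ∈ A × ∃[ u ] u ~ v × Reach k u

    Reach? : ∀ k v → Dec (Reach k v)
    Reach? zero    v = v ≟ a₀
    Reach? (suc k) v = v ∈? A ×-dec any? (λ u → u ~? v ×-dec Reach? k u)

    Reach⇒∈A : ∀ k → Reach k v → v ∈ A
    Reach⇒∈A zero    refl      = a₀∈A
    Reach⇒∈A (suc k) (v∈A , _) = v∈A

    ⟶*⇒Reach : ∀ k → Reach k u → u ⟨ A ⟩⟶* v → ∃[ j ] Reach j v
    ⟶*⇒Reach k ru ε                        = k , ru
    ⟶*⇒Reach k ru ((_ , w∈A , u~w) ◅ path) = ⟶*⇒Reach (suc k) (w∈A , _ , u~w , ru) path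

    abstract
      depths : ∀ v → ∃[ d ] (v ∈ A → Reach d v × (∀ {i} → i < d → ¬ Reach i v))
      depths v with v ∈? A
      ... | no v∉A  = 0 , λ v∈A → contradiction v∈A v∉A
      ... | yes v∈A with ⟶*⇒Reach 0 refl (A-connected a₀∈A v∈A)
      ...   | k , rk with least-witness (λ k → Reach? k v) k rk
      ...     | d , rd , ¬below = d , λ _ → rd , ¬below

    depth : Fin n → ℕ
    depth v = proj₁ (depths v)

    -- The sum is a crude upper bound for every single depth, so `M` lies above all levels in `A`.
    M : ℕ
    M = suc (sum depth)

    level : Fin n → ℕ
    level v with v ∈? A | v ∈? B
    ... | yes _ | _     = depth v
    ... | no _  | yes _ = M
    ... | no _  | no _  = suc M

    level-A : v ∈ A → level v ≡ depth v
    level-A {v} v∈A with v ∈? A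
    ... | yes _   = refl
    ... | no  v∉A = contradiction v∈A v∉A

    level-B : v ∉ A → v ∈ B → level v ≡ M
    level-B {v} v∉A v∈B with v ∈? A | v ∈? B
    ... | yes v∈A | _      = contradiction v∈A v∉A
    ... | no _    | yes _  = refl
    ... | no _    | no v∉B = contradiction v∈B v∉B

    level-rest : v ∉ A → v ∉ B → level v ≡ suc M
    level-rest {v} v∉A v∉B with v ∈? A | v ∈? B
    ... | yes v∈A | _       = contradiction v∈A v∉A
    ... | no _    | yes v∈B = contradiction v∈B v∉B
    ... | no _    | no _    = refl

    level-A<M : v ∈ A → level v < M
    level-A<M {v} v∈A = s≤s (≤-trans (≤-reflexive (level-A v∈A)) (term≤∑ depth v))

    level-B<1+M : v ∈ B → level v < suc M
    level-B<1+M {v} v∈B with v ∈? A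
    ... | yes v∈A = s≤s (≤-trans (term≤∑ depth v) (n≤1+n _))
    ... | no _ with v ∈? B
    ...   | yes _  = ≤-refl
    ...   | no v∉B = contradiction v∈B v∉B

    level≡0⇒a₀ : level v ≡ 0 → v ≡ a₀
    level≡0⇒a₀ {v} eq with v ∈? A
    ... | yes v∈A = subst (λ d → Reach d v) eq (proj₁ (proj₂ (depths v) v∈A))
    ... | no _ with v ∈? B | eq
    ...   | yes _ | ()
    ...   | no _  | ()

    -- The lexicographic order by level, then by node number, coded as one number since `toℕ v < n`.
    rank : Fin n → ℕ
    rank v = level v * n + toℕ v

    level<⇒rank< : ∀ u v → level u < level v → rank u < rank v
    level<⇒rank< u v lt = begin-strict
      level u * n + toℕ u <⟨ +-monoʳ-< (level u * n) (toℕ<n u) ⟩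
      level u * n + n     ≡⟨ +-comm (level u * n) n ⟩
      suc (level u) * n   ≤⟨ *-monoˡ-≤ n lt ⟩
      level v * n         ≤⟨ m≤m+n (level v * n) (toℕ v) ⟩
      rank v              ∎
      where open ≤-Reasoning

    rank≤⇒level≤ : ∀ u v → rank u ≤ rank v → level u ≤ level v
    rank≤⇒level≤ u v le with level u ℕ.≤? level v
    ... | yes l≤ = l≤
    ... | no  l≰ = contradiction le (<⇒≱ (level<⇒rank< v u (≰⇒> l≰)))

    rank-injective : rank u ≡ rank v → u ≡ v
    rank-injective {u} {v} eq = toℕ-injective (+-cancelˡ-≡ (level u * n) _ _ (trans eq
      (cong (λ l → l * n + toℕ v) (≤-antisym (rank≤⇒level≤ v u (≤-reflexive (sym eq))) (rank≤⇒level≤ u v (≤-reflexive eq))))))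

    -- The predecessor of `r` on a shortest walk from `a₀` has smaller depth. Depth 0 leaves only
    -- `a₀`, which no node precedes.
    rank-parent-A : r ∈ A → rank u < rank r → ∃[ c ] c ∈ T × rank c < rank r × c ~ r
    rank-parent-A {r} {u} r∈A u<r with depth r in eq | proj₂ (depths r) r∈A
    ... | zero  | r≡a₀ , _ = ⊥-elim (<-irrefl {rank u} {rank r} (cong rank {u} {r} (trans (level≡0⇒a₀ (n≤0⇒n≡0
            (≤-trans (rank≤⇒level≤ u r (<⇒≤ u<r)) (≤-reflexive (trans (level-A r∈A) eq))))) (sym r≡a₀))) u<r)
    ... | suc k | (_ , q , q~r , rq) , _ = q , A⊆T q∈A , level<⇒rank< q r level< , q~r
      where
      q∈A = Reach⇒∈A k rq
      level< : level q < level r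
      level< = ≤-<-trans (≤-reflexive (level-A q∈A))
        (≤-trans (s≤s (≮⇒≥ (λ k< → proj₂ (proj₂ (depths q) q∈A) k< rq))) (≤-reflexive (sym (trans (level-A r∈A) eq))))

    rank-parent : u ∈ T → r ∈ T → rank u < rank r → ∃[ c ] c ∈ T × rank c < rank r × c ~ r
    rank-parent {u} {r} _ r∈T u<r = by-tier (r ∈? A) (r ∈? B)
      where
      by-tier : Dec (r ∈ A) → Dec (r ∈ B) → ∃[ c ] c ∈ T × rank c < rank r × c ~ r
      by-tier (yes r∈A) _ = rank-parent-A {r} {u} r∈A u<r
      by-tier (no r∉A) (yes r∈B) with B-parent r∉A r∈B
      ... | a , a∈A , a~r = a , A⊆T a∈A
          , level<⇒rank< a r (<-≤-trans (level-A<M a∈A) (≤-reflexive (sym (level-B r∉A r∈B)))) , a~r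
      by-tier (no r∉A) (no r∉B) with rest-parents r∈T r∉A r∉B
      ... | a , _ , a∈A , _ , _ , _ , a~r , _ = a , A⊆T a∈A
          , level<⇒rank< a r (<-≤-trans (m<n⇒m<1+n (level-A<M a∈A)) (≤-reflexive (sym (level-rest r∉A r∉B)))) , a~r

    ranking : Ranking T
    ranking = record { rank = rank ; injective = λ {u} {v} → rank-injective {u} {v}
                     ; parent = λ {u} {r} → rank-parent {u} {r} }

    open Potential ranking

    joined-rest : r ∈ T → r ∉ A → r ∉ B → c ~ r → u ∈ T → u ≢ c → level u < suc M → u ~ r → Joined ⊥ c u r
    joined-rest {r} {u = u} r∈T r∉A r∉B c~r u∈T u≢c lt u~r =
      u∈T , u≢c , level<⇒rank< u r (<-≤-trans lt (≤-reflexive (sym (level-rest r∉A r∉B)))) ,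
      (∈T-c {S = ⊥} u∈T u≢c , ∈T-c {S = ⊥} r∈T (λ r≡c → irrefl (sym r≡c) c~r) , u~r) ◅ ε

    -- A node behind both tiers has two distinct earlier neighbours; one of them differs from `c`
    -- and stays joined to the node when `c` is removed.
    CutOffs⊥⊆A∪B : CutOffs ⊥ ⊆ A ∪ B
    CutOffs⊥⊆A∪B {r} r∈ with r ∈? A | r ∈? B
    ... | yes r∈A | _       = x∈p∪q⁺ (inj₁ r∈A)
    ... | no _    | yes r∈B = x∈p∪q⁺ (inj₂ r∈B)
    ... | no r∉A  | no r∉B with ∈⟪⟫⁻ (cutOff? ⊥) r∈
    ...   | r∈T , c , (_ , _ , c~r) , earliest with rest-parents r∈T r∉A r∉B
    ...     | a , b , a∈A , b∈B , b∈T , a≢b , a~r , b~r with a ≟ c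
    ...       | no  a≢c  = contradiction
      (a , joined-rest r∈T r∉A r∉B c~r (A⊆T a∈A) a≢c (m<n⇒m<1+n (level-A<M a∈A)) a~r) earliest
    ...       | yes refl = contradiction
      (b , joined-rest r∈T r∉A r∉B c~r b∈T (a≢b ∘ sym) (level-B<1+M b∈B) b~r) earliest

-- Sizes of the independent layers against a dominating set.

module Domination {n} (G : Graph n) (m : ℕ) where
  open Graph G

  private variable
    u v w x y c r : Fin n

  few-independent-neighbours : IsUnitDisk G → ∀ {I} → Independent G I → ∀ v → ∣ N G v ∩ I ∣ ≤ 5
  few-independent-neighbours unitDisk {I} independent v = ≮⇒≥ λ 6≤ →
    let ws , len , distinct , ws∈ = select 6 (N G v ∩ I) 6≤ in
    Plane.no-six-independent-neighbours G unitDisk ws (≤-reflexive (sym len))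
      (All.map (λ w∈ → ∈⟪⟫⁻ (v ~?_) (p∩q⊆p (N G v) I w∈)) ws∈)
      (AllPairs.map (λ (x∈ , y∈ , x≢y) → x≢y , independent (p∩q⊆q (N G v) I x∈) (p∩q⊆q (N G v) I y∈))
        (Plane.AllPairs-zipAll ws∈ distinct))

  N-symm : u ∈ N G v → v ∈ N G u
  N-symm {u} {v} u∈ = ∈⟪⟫⁺ (u ~?_) (symm (∈⟪⟫⁻ (v ~?_) u∈))

  -- Each node of `I ─ D` has `m` neighbours in `D`, none of them in `I` by independence; each node
  -- of `D ─ I` has at most five neighbours in `I`.
  independent-outside : IsUnitDisk G → ∀ {I D} → Independent G I → MDominating G m D →
                        m * ∣ I ─ D ∣ ≤ 5 * ∣ D ─ I ∣
  independent-outside unitDisk {I} {D} independent dominating =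
    double-counting (N G) (N G) N-symm (I ─ D) (D ─ I)
      (λ {v} v∈ → ≤-trans (dominating v (x∈p─q⇒x∉q {p = I} v∈))
        (p⊆q⇒∣p∣≤∣q∣ λ {u} u∈ → x∈p∩q⁺ (p∩q⊆p (N G v) D u∈ , x∈p∧x∉q⇒x∈p─q (p∩q⊆q (N G v) D u∈)
          λ u∈I → independent (p─q⊆p I D v∈) u∈I (∈⟪⟫⁻ (v ~?_) (p∩q⊆p (N G v) D u∈)))))
      (λ {u} _ → ≤-trans
        (p⊆q⇒∣p∣≤∣q∣ λ v∈ → x∈p∩q⁺ (p∩q⊆p (N G u) (I ─ D) v∈ , p─q⊆p I D (p∩q⊆q (N G u) (I ─ D) v∈)))
        (few-independent-neighbours unitDisk independent u))

  -- This is `m |I| ≤ (m − 5) |I ∩ D| + 5 |D|`, written without subtraction because `m` may be below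
  -- 5.
  independent-weight : IsUnitDisk G → ∀ {I D} → Independent G I → MDominating G m D →
                       m * ∣ I ∣ + 5 * ∣ I ∩ D ∣ ≤ m * ∣ I ∩ D ∣ + 5 * ∣ D ∣
  independent-weight unitDisk {I} {D} independent dominating = begin
    m * ∣ I ∣ + 5 * a           ≡⟨ cong (λ i → m * i + 5 * a) (∣p∣≡∣p∩q∣+∣p─q∣ I D) ⟩
    m * (a + b) + 5 * a         ≡⟨ solve 3 (λ m a b → m :* (a :+ b) :+ con 5 :* a := m :* a :+ con 5 :* a :+ m :* b) refl m a b ⟩
    m * a + 5 * a + m * b       ≤⟨ +-monoʳ-≤ (m * a + 5 * a) (independent-outside unitDisk independent dominating) ⟩
    m * a + 5 * a + 5 * d       ≡⟨ solve 3 (λ m a d → m :* a :+ con 5 :* a :+ con 5 :* d := m :* a :+ con 5 :* (a :+ d)) refl m a d ⟩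
    m * a + 5 * (a + d)         ≡⟨ cong (λ e → m * a + 5 * (e + d)) (cong ∣_∣ (∩-comm I D)) ⟩
    m * a + 5 * (∣ D ∩ I ∣ + d) ≡⟨ cong (λ d → m * a + 5 * d) (sym (∣p∣≡∣p∩q∣+∣p─q∣ D I)) ⟩
    m * a + 5 * ∣ D ∣           ∎
    where
    open ≤-Reasoning
    open +-*-Solver
    a = ∣ I ∩ D ∣
    b = ∣ I ─ D ∣
    d = ∣ D ─ I ∣

  -- Without such a neighbour, `v` could be added to `I`.
  maximal⇒neighbour : ∀ {W I} → IsMaximalIndependentIn G W I → v ∈ W → v ∉ I → ∃[ u ] u ∈ I × u ~ v
  maximal⇒neighbour {v} {W} {I} (I⊆W , independent , maximal) v∈W v∉I with any? (λ u → u ∈? I ×-dec u ~? v)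
  ... | yes neighbour = neighbour
  ... | no  isolated  = contradiction (maximal (I ∪ ⁅ v ⁆) ⊆W independent′ (p⊆p∪q ⁅ v ⁆) (q⊆p∪q I ⁅ v ⁆ (x∈⁅x⁆ v))) v∉I
    where
    cases : x ∈ I ∪ ⁅ v ⁆ → x ∈ I ⊎ x ≡ v
    cases x∈ = [ inj₁ , inj₂ ∘ x∈⁅y⁆⇒x≡y v ]′ (x∈p∪q⁻ I ⁅ v ⁆ x∈)

    ⊆W : I ∪ ⁅ v ⁆ ⊆ W
    ⊆W x∈ with cases x∈
    ... | inj₁ x∈I  = I⊆W x∈I
    ... | inj₂ refl = v∈W

    independent′ : Independent G (I ∪ ⁅ v ⁆)
    independent′ x∈ y∈ x~y with cases x∈ | cases y∈
    ... | inj₁ x∈I  | inj₁ y∈I  = independent x∈I y∈I x~y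
    ... | inj₁ x∈I  | inj₂ refl = isolated (_ , x∈I , x~y)
    ... | inj₂ refl | inj₁ y∈I  = isolated (_ , y∈I , symm x~y)
    ... | inj₂ refl | inj₂ refl = irrefl refl x~y

  module Layers {T : Subset n} (initial : Initial G m T) where
    open Initial initial

    -- The index is shifted so that `I (suc k)` is chosen outside `J k`.
    J : ℕ → Subset n
    J k = ⋃[<_] G (suc k) I

    layer-disjoint : ∀ {k} → k < m → x ∈ J k → x ∉ I (suc k)
    layer-disjoint {k = k} k<m x∈J x∈I = x∈∁p⇒x∉p (proj₁ (I-maximal (suc k) (s≤s z≤n) k<m) x∈I) x∈J

    layer-neighbour : ∀ {k} → k < m → v ∉ J (suc k) → ∃[ u ] u ∈ I (suc k) × u ~ v
    layer-neighbour {k = k} k<m v∉J = maximal⇒neighbour (I-maximal (suc k) (s≤s z≤n) k<m)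
      (x∉p⇒x∈∁p (v∉J ∘ p⊆p∪q _)) (v∉J ∘ q⊆p∪q _ _)

    J₀-empty : x ∉ J 0
    J₀-empty x∈ with x∈p∪q⁻ ⊥ (I 0) x∈
    ... | inj₁ x∈⊥ = ∉⊥ x∈⊥
    ... | inj₂ x∈I₀ = ∉⊥ (subst (_ ∈_) I₀-empty x∈I₀)

    ∣J₀∣≡0 : ∣ J 0 ∣ ≡ 0
    ∣J₀∣≡0 = trans (cong ∣_∣ (Empty-unique λ (_ , x∈) → J₀-empty x∈)) (∣⊥∣≡0 n)

    -- Every layer contributes a neighbour by maximality, and the layers are disjoint.
    J-neighbours : ∀ k → k ≤ m → v ∉ J k → k ≤ ∣ N G v ∩ J k ∣
    J-neighbours zero    _   _   = z≤n
    J-neighbours {v} (suc k) k<m v∉J with layer-neighbour k<m v∉J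
    ... | u , u∈I , u~v = ≤-trans (s≤s (J-neighbours k (<⇒≤ k<m) (v∉J ∘ p⊆p∪q _)))
      (p⊂q⇒∣p∣<∣q∣
        ( (λ x∈ → x∈p∩q⁺ (p∩q⊆p (N G v) (J k) x∈ , p⊆p∪q _ (p∩q⊆q (N G v) (J k) x∈)))
        , u , x∈p∩q⁺ (∈⟪⟫⁺ (v ~?_) (symm u~v) , q⊆p∪q (J k) _ u∈I)
        , λ u∈ → layer-disjoint k<m (p∩q⊆q (N G v) (J k) u∈) u∈I))

    J⊆T : J m ⊆ T
    J⊆T x∈ = subst (_ ∈_) (sym T-def) (p⊆p∪q C x∈)

    dominating : ∀ S → MDominating G m (T ∪ S)
    dominating S v v∉ = ≤-trans (J-neighbours m ≤-refl (v∉ ∘ p⊆p∪q S ∘ J⊆T))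
      (p⊆q⇒∣p∣≤∣q∣ λ x∈ → x∈p∩q⁺ (p∩q⊆p (N G v) (J m) x∈ , p⊆p∪q S (J⊆T (p∩q⊆q (N G v) (J m) x∈))))

    module _ (unitDisk : IsUnitDisk G) {D : Subset n} (D-dominating : MDominating G m D) where

      layer-weight : ∀ {k} → k < m → m * ∣ I (suc k) ∣ + 5 * ∣ I (suc k) ∩ D ∣ ≤ m * ∣ I (suc k) ∩ D ∣ + 5 * ∣ D ∣
      layer-weight {k} k<m =
        independent-weight unitDisk (proj₁ (proj₂ (I-maximal (suc k) (s≤s z≤n) k<m))) D-dominating

      J-weight : ∀ k → k ≤ m → m * ∣ J k ∣ + 5 * ∣ J k ∩ D ∣ ≤ m * ∣ J k ∩ D ∣ + k * (5 * ∣ D ∣)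
      J-weight zero _ = begin
        m * ∣ J 0 ∣ + 5 * ∣ J 0 ∩ D ∣ ≤⟨ +-mono-≤ (≤-reflexive (cong (m *_) ∣J₀∣≡0)) (*-monoʳ-≤ 5 (≤-trans (∣p∩q∣≤∣p∣ (J 0) D) (≤-reflexive ∣J₀∣≡0))) ⟩
        m * 0 + 0                   ≡⟨ cong (_+ 0) (*-zeroʳ m) ⟩
        0                           ≤⟨ z≤n ⟩
        m * ∣ J 0 ∩ D ∣ + 0           ∎
        where open ≤-Reasoning
      J-weight (suc k) k<m = begin
        m * ∣ J (suc k) ∣ + 5 * ∣ J (suc k) ∩ D ∣
          ≡⟨ cong₂ (λ a b → m * a + 5 * b) (disjoint⇒∣p∪q∣≡∣p∣+∣q∣ (J k) (I (suc k)) (layer-disjoint k<m)) split ⟩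
        m * (∣ J k ∣ + ∣ I (suc k) ∣) + 5 * (∣ J k ∩ D ∣ + ∣ I (suc k) ∩ D ∣)
          ≡⟨ solve 5 (λ m a b c d → m :* (a :+ b) :+ con 5 :* (c :+ d) := (m :* a :+ con 5 :* c) :+ (m :* b :+ con 5 :* d))
               refl m (∣ J k ∣) (∣ I (suc k) ∣) (∣ J k ∩ D ∣) (∣ I (suc k) ∩ D ∣) ⟩
        (m * ∣ J k ∣ + 5 * ∣ J k ∩ D ∣) + (m * ∣ I (suc k) ∣ + 5 * ∣ I (suc k) ∩ D ∣)
          ≤⟨ +-mono-≤ (J-weight k (<⇒≤ k<m)) (layer-weight k<m) ⟩
        (m * ∣ J k ∩ D ∣ + k * (5 * ∣ D ∣)) + (m * ∣ I (suc k) ∩ D ∣ + 5 * ∣ D ∣)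
          ≡⟨ solve 5 (λ m c d k o → (m :* c :+ k :* o) :+ (m :* d :+ o) := m :* (c :+ d) :+ (o :+ k :* o))
               refl m (∣ J k ∩ D ∣) (∣ I (suc k) ∩ D ∣) k (5 * ∣ D ∣) ⟩
        m * (∣ J k ∩ D ∣ + ∣ I (suc k) ∩ D ∣) + suc k * (5 * ∣ D ∣)
          ≡⟨ cong (λ d → m * d + suc k * (5 * ∣ D ∣)) (sym split) ⟩
        m * ∣ J (suc k) ∩ D ∣ + suc k * (5 * ∣ D ∣) ∎
        where
        open ≤-Reasoning
        open +-*-Solver
        split : ∣ J (suc k) ∩ D ∣ ≡ ∣ J k ∩ D ∣ + ∣ I (suc k) ∩ D ∣
        split = trans (cong ∣_∣ (∩-distribʳ-∪ D (J k) (I (suc k))))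
          (disjoint⇒∣p∪q∣≡∣p∣+∣q∣ (J k ∩ D) (I (suc k) ∩ D) λ x∈ x∈′ →
            layer-disjoint k<m (p∩q⊆p (J k) D x∈) (p∩q⊆p (I (suc k)) D x∈′))

    augmentation-size : 2 ≤ m → ∀ {S} → Star (Step G T) ⊥ S → ∣ S ∣ ≤ 2 * ((∣ C ∣ + ∣ I 1 ∣) + ∣ I 2 ∣)
    augmentation-size 2≤m {S} run with nonempty? (I 1)
    -- If `I 1` is empty, its maximality leaves no node at all in the graph.
    ... | no empty = ≤-trans (≤-reflexive (trans (cong ∣_∣ (Empty-unique S-empty)) (∣⊥∣≡0 n))) z≤n
      where
      S-empty : Empty S
      S-empty (v , _) = empty (_ , proj₁ (proj₂ (layer-neighbour (≤-trans (s≤s z≤n) 2≤m)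
        (λ v∈ → [ J₀-empty , (λ v∈I → empty (v , v∈I)) ]′ (x∈p∪q⁻ (J 0) (I 1) v∈)))))
    ... | yes (a₀ , a₀∈I₁) = begin
      ∣ S ∣                               ≤⟨ m≤m+n ∣ S ∣ _ ⟩
      ∣ S ∣ + 2 * ∣ CutOffs S ∣                 ≤⟨ Steps.execution-size G ranking run ⟩
      ∣ ⊥ {n} ∣ + 2 * ∣ CutOffs ⊥ ∣             ≡⟨ cong (_+ 2 * ∣ CutOffs ⊥ ∣) (∣⊥∣≡0 n) ⟩
      2 * ∣ CutOffs ⊥ ∣                         ≤⟨ *-monoʳ-≤ 2 (p⊆q⇒∣p∣≤∣q∣ CutOffs⊥⊆A∪B) ⟩
      2 * ∣ A ∪ I 2 ∣                     ≤⟨ *-monoʳ-≤ 2 (∣p∪q∣≤∣p∣+∣q∣ A (I 2)) ⟩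
      2 * (∣ A ∣ + ∣ I 2 ∣)               ≤⟨ *-monoʳ-≤ 2 (+-monoˡ-≤ ∣ I 2 ∣ (∣p∪q∣≤∣p∣+∣q∣ C (I 1))) ⟩
      2 * ((∣ C ∣ + ∣ I 1 ∣) + ∣ I 2 ∣)   ∎
      where
      open ≤-Reasoning
      A = C ∪ I 1

      ∉J₁ : v ∉ A → v ∉ J 1
      ∉J₁ v∉A v∈ = [ J₀-empty , v∉A ∘ q⊆p∪q C (I 1) ]′ (x∈p∪q⁻ (J 0) (I 1) v∈)

      ∉J₂ : v ∉ A → v ∉ I 2 → v ∉ J 2
      ∉J₂ v∉A v∉I₂ v∈ = [ ∉J₁ v∉A , v∉I₂ ]′ (x∈p∪q⁻ (J 1) (I 2) v∈)

      J-mono : ∀ {j k} → j ℕ.≤′ k → J j ⊆ J k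
      J-mono ℕ.≤′-refl       x∈ = x∈
      J-mono (ℕ.≤′-step j≤k) x∈ = p⊆p∪q _ (J-mono j≤k x∈)

      A⊆T : A ⊆ T
      A⊆T x∈ = [ (λ x∈C → subst (_ ∈_) (sym T-def) (q⊆p∪q (J m) C x∈C))
               , (λ x∈I → J⊆T (J-mono (≤⇒≤′ (≤-trans (s≤s z≤n) 2≤m)) (q⊆p∪q (J 0) (I 1) x∈I))) ]′ (x∈p∪q⁻ C (I 1) x∈)

      neighbour-A : v ∉ A → ∃[ a ] (a ∈ I 1) × a ~ v
      neighbour-A v∉A = layer-neighbour (≤-trans (s≤s z≤n) 2≤m) (∉J₁ v∉A)

      B-parent : v ∉ A → v ∈ I 2 → ∃[ a ] a ∈ A × a ~ v
      B-parent v∉A _ with neighbour-A v∉A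
      ... | a , a∈I₁ , a~v = a , q⊆p∪q C (I 1) a∈I₁ , a~v

      rest-parents : v ∈ T → v ∉ A → v ∉ I 2 → ∃[ a ] ∃[ b ] a ∈ A × b ∈ I 2 × b ∈ T × a ≢ b × a ~ v × b ~ v
      rest-parents _ v∉A v∉I₂ with neighbour-A v∉A | layer-neighbour 2≤m (∉J₂ v∉A v∉I₂)
      ... | a , a∈I₁ , a~v | b , b∈I₂ , b~v = a , b , q⊆p∪q C (I 1) a∈I₁ , b∈I₂
        , J⊆T (J-mono (≤⇒≤′ 2≤m) (q⊆p∪q (J 1) (I 2) b∈I₂))
        , (λ { refl → layer-disjoint 2≤m (q⊆p∪q (J 0) (I 1) a∈I₁) b∈I₂ }) , a~v , b~v

      open Steps.TieredRanking G A (I 2) T a₀ (q⊆p∪q C (I 1) a₀∈I₁) C-connected A⊆T B-parent rest-parents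
        using (ranking; CutOffs⊥⊆A∪B)
      open Connectivity.Potential G ranking using (CutOffs)

-- Arithmetic of the two approximation factors.

module Bounds where

  open ≤-Reasoning
  open +-*-Solver

  module _ {m a x p : ℕ} (h : m * a + 5 * x ≤ m * x + p) where

    light : m ≤ 5 → m * a ≤ p
    light m≤5 = +-cancelʳ-≤ (5 * x) (m * a) p (begin
      m * a + 5 * x ≤⟨ h ⟩
      m * x + p     ≤⟨ +-monoˡ-≤ p (*-monoˡ-≤ x m≤5) ⟩
      5 * x + p     ≡⟨ +-comm (5 * x) p ⟩
      p + 5 * x     ∎)

    -- The coefficient `m − 5` of `x` is nonnegative, so `x` can be raised to `o`.
    heavy : 5 ≤ m → ∀ {o} → x ≤ o → m * a + 5 * o ≤ m * o + p
    heavy 5≤m {o} x≤o with m≤n⇒∃[o]m+o≡n 5≤m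
    ... | e , refl = begin
      (5 + e) * a + 5 * o ≤⟨ +-monoˡ-≤ (5 * o) small ⟩
      (e * o + p) + 5 * o ≡⟨ solve 3 (λ e o p → (e :* o :+ p) :+ con 5 :* o := (con 5 :+ e) :* o :+ p) refl e o p ⟩
      (5 + e) * o + p     ∎
      where
      small : (5 + e) * a ≤ e * o + p
      small = +-cancelʳ-≤ (5 * x) _ _ (begin
        (5 + e) * a + 5 * x ≤⟨ h ⟩
        (5 + e) * x + p     ≡⟨ solve 3 (λ e x p → (con 5 :+ e) :* x :+ p := (e :* x :+ p) :+ con 5 :* x) refl e x p ⟩
        (e * x + p) + 5 * x ≤⟨ +-monoˡ-≤ (5 * x) (+-monoˡ-≤ p (*-monoʳ-≤ e x≤o)) ⟩
        (e * o + p) + 5 * x ∎)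

  module _ {m t u c a₁ a₂ : ℕ} (c≤a₁ : c ≤ a₁) (t≤ : t ≤ (u + c) + 2 * ((c + a₁) + a₂)) where

    -- Replacing `c` by `a₁` leaves `u + 5 a₁ + 2 a₂`: one `a₁` for `C` as part of `T`, and four for
    -- the doubled `C` and `I 1`.
    total : m * t ≤ m * u + (5 * (m * a₁) + 2 * (m * a₂))
    total = begin
      m * t                                ≤⟨ *-monoʳ-≤ m t≤ ⟩
      m * ((u + c) + 2 * ((c + a₁) + a₂))  ≤⟨ *-monoʳ-≤ m (+-mono-≤ (+-monoʳ-≤ u c≤a₁) (*-monoʳ-≤ 2 (+-monoˡ-≤ a₂ (+-monoˡ-≤ a₁ c≤a₁)))) ⟩
      m * ((u + a₁) + 2 * ((a₁ + a₁) + a₂))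
        ≡⟨ solve 4 (λ m u a b → m :* ((u :+ a) :+ con 2 :* ((a :+ a) :+ b)) := m :* u :+ (con 5 :* (m :* a) :+ con 2 :* (m :* b))) refl m u a₁ a₂ ⟩
      m * u + (5 * (m * a₁) + 2 * (m * a₂)) ∎

    -- The constant 35 is `5 · 5 + 2 · 5`, from `a₁` and `a₂`.
    total-light : ∀ {o} → m * u ≤ m * (5 * o) → m * a₁ ≤ 5 * o → m * a₂ ≤ 5 * o → m * t ≤ (5 * m + 35) * o
    total-light {o} u≤ a₁≤ a₂≤ = begin
      m * t                                        ≤⟨ total ⟩
      m * u + (5 * (m * a₁) + 2 * (m * a₂))        ≤⟨ +-mono-≤ u≤ (+-mono-≤ (*-monoʳ-≤ 5 a₁≤) (*-monoʳ-≤ 2 a₂≤)) ⟩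
      m * (5 * o) + (5 * (5 * o) + 2 * (5 * o))
        ≡⟨ solve 2 (λ m o → m :* (con 5 :* o) :+ (con 5 :* (con 5 :* o) :+ con 2 :* (con 5 :* o)) := (con 5 :* m :+ con 35) :* o) refl m o ⟩
      (5 * m + 35) * o                             ∎

    -- The hypotheses on `a₁` and `a₂` amount to `m a₁ ≤ m o` and `m a₂ ≤ m o`, so 13 is
    -- `6 + 5 + 2`, with the 6 and the `− 5` coming from `u`.
    total-heavy : ∀ {o} → m * u + 5 * o ≤ m * o + m * (5 * o) →
                  m * a₁ + 5 * o ≤ m * o + 5 * o → m * a₂ + 5 * o ≤ m * o + 5 * o → m * t + 5 * o ≤ 13 * m * o
    total-heavy {o} u≤ a₁≤ a₂≤ = begin
      m * t + 5 * o                                          ≤⟨ +-monoˡ-≤ (5 * o) total ⟩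
      (m * u + (5 * (m * a₁) + 2 * (m * a₂))) + 5 * o
        ≡⟨ solve 3 (λ x y z → (x :+ y) :+ z := (x :+ z) :+ y) refl (m * u) (5 * (m * a₁) + 2 * (m * a₂)) (5 * o) ⟩
      (m * u + 5 * o) + (5 * (m * a₁) + 2 * (m * a₂))
        ≤⟨ +-mono-≤ u≤ (+-mono-≤ (*-monoʳ-≤ 5 (+-cancelʳ-≤ (5 * o) (m * a₁) (m * o) a₁≤)) (*-monoʳ-≤ 2 (+-cancelʳ-≤ (5 * o) (m * a₂) (m * o) a₂≤))) ⟩
      (m * o + m * (5 * o)) + (5 * (m * o) + 2 * (m * o))
        ≡⟨ solve 2 (λ m o → (m :* o :+ m :* (con 5 :* o)) :+ (con 5 :* (m :* o) :+ con 2 :* (m :* o)) := con 13 :* m :* o) refl m o ⟩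
      13 * m * o ∎

-- The approximation factors of the algorithm.

open import Data.Integer using (+_)
open import Data.Rational using (_/_)

theorem4 : (m : ℕ) .{{_ : NonZero m}} → 2 ≤ m →
    {n : ℕ} (G : Graph n) → IsUnitDisk G →
    (opt : ℕ) → IsMinCDSSize G 2 m opt →
    (T S : Subset n) → IsOutput G m T S →
    IsCDS G 2 m (T ∪ S)
    × (m ≤ 5 → size (T ∪ S) ℚ.≤ ((+ 5 / 1) ℚ.+ (+ 35 / m)) ℚ.* (+ opt / 1))
    × (6 ≤ m → size (T ∪ S) ℚ.≤ ((+ 13 / 1) ℚ.- (+ 5 / m)) ℚ.* (+ opt / 1))
theorem4 m 2≤m {n} G unitDisk opt ((D , (_ , D-dominating) , refl) , _) T S (initial , run , biconnected) =
  (biconnected , dominating S) ,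
  (λ m≤5 → ratio-light m (total-light {m} C-small T∪S≤ {o}
    (light {m} J≤ m≤5) (light {m} (layer 0 1≤m) m≤5) (light {m} (layer 1 2≤m) m≤5))) ,
  (λ 6≤m → let 5≤m = ≤-trans (n≤1+n 5) 6≤m in ratio-heavy m (total-heavy {m} C-small T∪S≤ {o}
    (heavy {m} J≤ 5≤m (∣p∩q∣≤∣q∣ (J m) D)) (heavy {m} (layer 0 1≤m) 5≤m (∣p∩q∣≤∣q∣ (I 1) D))
    (heavy {m} (layer 1 2≤m) 5≤m (∣p∩q∣≤∣q∣ (I 2) D))))
  where
  open Ratio
  open Bounds
  open Initial initial
  open Domination G m
  open Layers initial
  o = ∣ D ∣
  1≤m : 1 ≤ m
  1≤m = ≤-trans (s≤s z≤n) 2≤m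

  J≤ : m * ∣ J m ∣ + 5 * ∣ J m ∩ D ∣ ≤ m * ∣ J m ∩ D ∣ + m * (5 * o)
  J≤ = J-weight unitDisk D-dominating m ≤-refl

  layer : ∀ k → k < m → m * ∣ I (suc k) ∣ + 5 * ∣ I (suc k) ∩ D ∣ ≤ m * ∣ I (suc k) ∩ D ∣ + 5 * o
  layer k = layer-weight unitDisk D-dominating

  T∪S≤ : ∣ T ∪ S ∣ ≤ (∣ J m ∣ + ∣ C ∣) + 2 * ((∣ C ∣ + ∣ I 1 ∣) + ∣ I 2 ∣)
  T∪S≤ = ≤-trans (∣p∪q∣≤∣p∣+∣q∣ T S) (+-mono-≤
    (≤-trans (≤-reflexive (cong ∣_∣ T-def)) (∣p∪q∣≤∣p∣+∣q∣ (J m) C)) (augmentation-size 2≤m run))
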